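{- Let $G$ be a finite abelian group of order $n \geq 2$ and let $h$ be a positive integer. Then $$\widehat{\chi}(G,h)=\chi(G,h)=v(n,h)+1.$$
   Context: Groups are written additively. For a nonempty subset $A$ of $G$ and a positive integer $h$, $hA$ denotes the $h$-fold sumset of $A$, i.e. the set of all sums $a_1+\cdots+a_h$ of $h$ not-necessarily-distinct elements of $A$. $\langle A\rangle$ denotes the subgroup of $G$ generated by $A$; $A$ is a generating set of $G$ if $\langle A\rangle=G$. Define $$\chi(G,h)=\min\{m : \text{for every } A\subseteq G \text{ with } |A|\ge m,\ hA=G\},$$ $$\widehat{\chi}(G,h)=\min\{m : \text{for every } A\subseteq G \text{ with } \langle A\rangle=G \text{ and } |A|\ge m,\ hA=G\}.$$ Let $D(n)$ be the set of positive divisors of $n$. For $d\in D(n)$ set $$f_d(n,h)=\left(\left\lfloor \frac{d-2}{h}\right\rfloor+1\right)\cdot\frac{n}{d},$$ and let $v(n,h)=\max\{f_d(n,h) : d\in D(n)\}$. -}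

module Defs where

open import Level using (0ℓ)
open import Data.Nat using (ℕ; zero; suc; _+_; _*_; _∸_; _≤_; _⊔_; NonZero)
open import Data.Nat.DivMod using (_/_)
open import Data.Nat.Divisibility using (_∣?_)
open import Data.List using (List; foldr; filter; upTo; map)
open import Data.Fin using (Fin)
open import Data.Fin.Subset using (Subset; _∈_; ∣_∣)
open import Data.Vec using (Vec)
import Data.Vec as Vec
open import Data.Vec.Relation.Unary.All using (All)
open import Data.Product using (∃; _×_)
open import Relation.Binary.PropositionalEquality using (_≡_)
open import Algebra.Structures using (IsAbelianGroup)

-- A finite abelian group of order n, presented (up to isomorphism) on the
-- carrier Fin n with propositional equality.
record FinAbGroup (n : ℕ) : Set where
  field
    _∙_ : Fin n → Fin n → Fin n
    ε   : Fin n
    _⁻¹ : Fin n → Fin n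
    isAbelianGroup : IsAbelianGroup _≡_ _∙_ ε _⁻¹

module _ {n : ℕ} (G : FinAbGroup n) where
  open FinAbGroup G

  vsum : ∀ {k} → Vec (Fin n) k → Fin n
  vsum = Vec.foldr _ _∙_ ε

  InSumset : ℕ → Subset n → Fin n → Set
  InSumset h A x = ∃ λ (v : Vec (Fin n) h) → All (_∈ A) v × vsum v ≡ x

  SumsetFull : ℕ → Subset n → Set
  SumsetFull h A = ∀ x → InSumset h A x

  data InGen (A : Subset n) : Fin n → Set where
    gen : ∀ {x} → x ∈ A → InGen A x
    unit : InGen A ε
    op  : ∀ {x y} → InGen A x → InGen A y → InGen A (x ∙ y)
    inv : ∀ {x} → InGen A x → InGen A (x ⁻¹)

  Generates : Subset n → Set
  Generates A = ∀ x → InGen A x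

  -- property whose least witness is χ(G,h)
  ChiProp : ℕ → ℕ → Set
  ChiProp h m = ∀ (A : Subset n) → m ≤ ∣ A ∣ → SumsetFull h A

  -- property whose least witness is χ̂(G,h)
  ChiHatProp : ℕ → ℕ → Set
  ChiHatProp h m = ∀ (A : Subset n) → Generates A → m ≤ ∣ A ∣ → SumsetFull h A

IsMinimum : (ℕ → Set) → ℕ → Set
IsMinimum P m = P m × (∀ k → P k → m ≤ k)

divisors : ℕ → List ℕ
divisors n = filter (_∣? n) (map suc (upTo n))

-- f_d(n,h) = (⌊(d-2)/h⌋ + 1) · n/d ; for d = 1, ⌊-1/h⌋ = -1 so f_1 = 0.
f : (d n h : ℕ) → .{{NonZero h}} → ℕ
f zero          n h = 0
f (suc zero)    n h = 0
f (suc (suc k)) n h = (k / h + 1) * (n / suc (suc k))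

v : (n h : ℕ) → .{{NonZero h}} → ℕ
v n h = foldr (λ d m → f d n h ⊔ m) 0 (divisors n)

{-# OPTIONS --safe #-}

-- Upper bound.  Suppose y ∉ hA.  Following Hamidoune, choose X with X + A ≠ G that
-- minimises |X + A| − |X|, and among those one of least cardinality.  Two translates of
-- X that meet coincide, so a translate of X is a subgroup H, and every X with X + A ≠ G
-- satisfies |X + A| ≥ |X| + k|H|, where A meets k + 1 cosets of H.  If y ∉ H + hA, then
-- iterating from X = H shows that H has index at least hk + 2.  If y ∈ H + hA, the parts of A
-- in two distinct cosets of H have together more than |H| elements, so their sum is a full
-- coset; hence y is only represented by sums of elements of a single coset a + H, the
-- index of H is at least hk + 1, and one recurses to the subset (A ∩ (a + H)) − a of H.
--
-- Lower bound.  Take a subgroup H of index d (Cauchy's theorem) and a chain of subgroups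
-- from H to G with cyclic quotients.  Lexicographic initial segments I along this chain that
-- consist of s cosets of H satisfy |hI| ≤ (h(s − 1) + 1)|H|.
--
-- A set of v(n,h) elements becomes generating after any translation that removes 0 from it.
module Submission where

open import Defs
open import Algebra.Bundles using (AbelianGroup)
import Algebra.Properties.CommutativeSemigroup as SemigroupProperties
import Algebra.Properties.Group as GroupProperties
import Algebra.Properties.Monoid.Mult as MonoidMultiples
import Algebra.Solver.CommutativeMonoid as CommutativeMonoidSolver
open import Data.Bool using (true; false)
open import Data.Fin using (Fin)
import Data.Fin as Fin
import Data.Fin.Properties as Finₚ
open import Data.Fin.Subset
open import Data.Fin.Subset.Properties
open import Data.List using (List; []; _∷_; foldr; map; upTo)
open import Data.List.Membership.Propositional using () renaming (_∈_ to _∈ˡ_)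
open import Data.List.Membership.Propositional.Properties using (∈-filter⁺; ∈-filter⁻; ∈-map⁺; ∈-upTo⁺)
import Data.List.Relation.Unary.All as List
open import Data.List.Relation.Unary.Any using (here; there)
open import Data.Nat hiding (∣_-_∣)
open import Data.Nat.Divisibility using (_∣_; divides; _∣?_; m%n≡0⇒n∣m; ∣1⇒≡1; n∣m*n; ∣⇒≤)
open import Data.Nat.DivMod
open import Data.Nat.Induction using (<-wellFounded)
open import Data.Nat.ListAction using (product)
open import Data.Nat.Primality using (Prime; euclidsLemma; prime⇒irreducible; prime⇒nonTrivial; ¬prime[1])
open import Data.Nat.Primality.Factorisation using (factorise; PrimeFactorisation)
open import Data.Nat.Properties
open import Data.Nat.Solver using (module +-*-Solver)
open import Data.Product using (∃; ∃₂; _×_; _,_; proj₁; proj₂)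
open import Data.Sum using (_⊎_; inj₁; inj₂; [_,_]′)
open import Data.Vec using ([]; _∷_; here; there; tabulate)
import Data.Vec as Vec
open import Data.Vec.N-ary using (N-ary; ∀ⁿ; curryⁿ; _$ⁿ_; left-inverse; uncurry-∀ⁿ)
open import Data.Vec.Properties using (lookup∘tabulate; lookup⇒[]=; []=⇒lookup)
open import Data.Vec.Relation.Unary.All using ([]; _∷_)
open import Function using (_∘_; Injective; Equivalence)
open import Induction.WellFounded using (Acc; acc)
open import Level using (0ℓ)
open import Relation.Binary.PropositionalEquality
  using (_≡_; _≢_; refl; sym; trans; cong; cong₂; subst; module ≡-Reasoning)
open import Relation.Nullary
open import Relation.Nullary.Decidable using (dec-true; decidable-stable)
open import Relation.Unary using (Decidable)
open +-*-Solver using (_:+_; _:*_; _:=_; con) renaming (solve to solveℕ)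

private variable
  n : ℕ

-- Finite subsets and their cardinalities.

module _ {P : Fin n → Set} where

  abstract
    subset : Decidable P → Subset n
    subset P? = tabulate (does ∘ P?)

    ∈-subset⁺ : (P? : Decidable P) → ∀ {x} → P x → x ∈ subset P?
    ∈-subset⁺ P? {x} px = lookup⇒[]= x _ (trans (lookup∘tabulate _ x) (dec-true (P? x) px))

    ∈-subset⁻ : (P? : Decidable P) → ∀ {x} → x ∈ subset P? → P x
    ∈-subset⁻ P? {x} x∈ with P? x | trans (sym (lookup∘tabulate (does ∘ P?) x)) ([]=⇒lookup x∈)
    ... | yes px | _ = px

∣p∣≡1+∣p-x∣ : ∀ {x} {p : Subset n} → x ∈ p → ∣ p ∣ ≡ suc ∣ p - x ∣
∣p∣≡1+∣p-x∣ {p = true ∷ p} here = cong (suc ∘ ∣_∣) (sym (p─⊥≡p p))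
∣p∣≡1+∣p-x∣ {p = true ∷ p} (there x∈p) = cong suc (∣p∣≡1+∣p-x∣ x∈p)
∣p∣≡1+∣p-x∣ {p = false ∷ p} (there x∈p) = ∣p∣≡1+∣p-x∣ x∈p

∣∪∣+∣∩∣ : ∀ (p q : Subset n) → ∣ p ∪ q ∣ + ∣ p ∩ q ∣ ≡ ∣ p ∣ + ∣ q ∣
∣∪∣+∣∩∣ [] [] = refl
∣∪∣+∣∩∣ (true ∷ p) (true ∷ q) = cong suc (trans (+-suc _ _) (trans (cong suc (∣∪∣+∣∩∣ p q)) (sym (+-suc _ _))))
∣∪∣+∣∩∣ (true ∷ p) (false ∷ q) = cong suc (∣∪∣+∣∩∣ p q)
∣∪∣+∣∩∣ (false ∷ p) (true ∷ q) = trans (cong suc (∣∪∣+∣∩∣ p q)) (sym (+-suc _ _))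
∣∪∣+∣∩∣ (false ∷ p) (false ∷ q) = ∣∪∣+∣∩∣ p q

∣∪∣≤ : ∀ (p q : Subset n) → ∣ p ∪ q ∣ ≤ ∣ p ∣ + ∣ q ∣
∣∪∣≤ p q = ≤-trans (m≤m+n ∣ p ∪ q ∣ ∣ p ∩ q ∣) (≤-reflexive (∣∪∣+∣∩∣ p q))

Disjoint : Subset n → Subset n → Set
Disjoint p q = ∀ {x} → x ∈ p → x ∉ q

∣⊎∣≤ : ∀ {p q r : Subset n} → Disjoint p q → p ⊆ r → q ⊆ r → ∣ p ∣ + ∣ q ∣ ≤ ∣ r ∣
∣⊎∣≤ {n} {p} {q} {r} p∥q p⊆r q⊆r = begin
  ∣ p ∣ + ∣ q ∣          ≡⟨ ∣∪∣+∣∩∣ p q ⟨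
  ∣ p ∪ q ∣ + ∣ p ∩ q ∣  ≡⟨ cong (λ s → ∣ p ∪ q ∣ + ∣ s ∣) p∩q≡⊥ ⟩
  ∣ p ∪ q ∣ + ∣ ⊥ {n} ∣  ≡⟨ cong (∣ p ∪ q ∣ +_) (∣⊥∣≡0 n) ⟩
  ∣ p ∪ q ∣ + 0          ≡⟨ +-identityʳ _ ⟩
  ∣ p ∪ q ∣              ≤⟨ p⊆q⇒∣p∣≤∣q∣ ([ p⊆r , q⊆r ]′ ∘ x∈p∪q⁻ p q) ⟩
  ∣ r ∣                  ∎
  where
  open ≤-Reasoning
  p∩q≡⊥ : p ∩ q ≡ ⊥
  p∩q≡⊥ = Empty-unique λ (x , x∈) → let x∈p , x∈q = x∈p∩q⁻ p q x∈ in p∥q x∈p x∈q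

∣cover∣≤ : ∀ {p q r : Subset n} → (∀ {x} → x ∈ r → x ∈ p ⊎ x ∈ q) → ∣ r ∣ ≤ ∣ p ∣ + ∣ q ∣
∣cover∣≤ {p = p} {q} r⊆ = ≤-trans (p⊆q⇒∣p∣≤∣q∣ (x∈p∪q⁺ ∘ r⊆)) (∣∪∣≤ p q)

nonempty⇒0<∣∣ : ∀ {x} {p : Subset n} → x ∈ p → 0 < ∣ p ∣
nonempty⇒0<∣∣ x∈p = ≤-trans (s≤s z≤n) (≤-reflexive (sym (∣p∣≡1+∣p-x∣ x∈p)))

0<∣∣⇒nonempty : ∀ {p : Subset n} → 0 < ∣ p ∣ → Nonempty p
0<∣∣⇒nonempty {n} {p} 0<p with nonempty? p
... | yes ne = ne
... | no ¬ne = contradiction 0<p (≤⇒≯ (≤-reflexive (trans (cong ∣_∣ (Empty-unique ¬ne)) (∣⊥∣≡0 n))))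

∈-⁻ : ∀ {p : Subset n} {x y} → y ∈ p - x → y ∈ p × y ≢ x
∈-⁻ {p = p} {x} y∈ = p─q⊆p p ⁅ x ⁆ y∈ , λ { refl → x∉p-x p y∈ }
  where
  x∉p-x : ∀ {n x} (p : Subset n) → x ∉ p - x
  x∉p-x {x = Fin.zero} (true ∷ p) ()
  x∉p-x {x = Fin.zero} (false ∷ p) ()
  x∉p-x {x = Fin.suc x} (_ ∷ p) (there x∈) = x∉p-x p x∈

∣∣-injection : ∀ {f : Fin n → Fin n} → Injective _≡_ _≡_ f → ∀ {p q : Subset n} →
               (∀ {x} → x ∈ p → f x ∈ q) → ∣ p ∣ ≤ ∣ q ∣
∣∣-injection {n} {f} inj {p} {q} = go p (<-wellFounded ∣ p ∣) {q}
  where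
  go : ∀ p → Acc _<_ ∣ p ∣ → ∀ {q} → (∀ {x} → x ∈ p → f x ∈ q) → ∣ p ∣ ≤ ∣ q ∣
  go p (acc rec) {q} f∈ with nonempty? p
  ... | no ¬ne = ≤-trans (≤-reflexive (trans (cong ∣_∣ (Empty-unique ¬ne)) (∣⊥∣≡0 n))) z≤n
  ... | yes (x , x∈p) = begin
    ∣ p ∣              ≡⟨ ∣p∣≡1+∣p-x∣ x∈p ⟩
    suc ∣ p - x ∣      ≤⟨ s≤s (go (p - x) (rec (x∈p⇒∣p-x∣<∣p∣ x∈p)) f∈′) ⟩
    suc ∣ q - f x ∣    ≡⟨ ∣p∣≡1+∣p-x∣ (f∈ x∈p) ⟨
    ∣ q ∣              ∎
    where
    open ≤-Reasoning
    f∈′ : ∀ {y} → y ∈ p - x → f y ∈ q - f x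
    f∈′ y∈ = let y∈p , y≢x = ∈-⁻ {p = p} y∈ in x∈p∧x≢y⇒x∈p-y (f∈ y∈p) (y≢x ∘ inj)

p⊆q⇒∣q∣≤∣p∣⇒q⊆p : ∀ {p q : Subset n} → p ⊆ q → ∣ q ∣ ≤ ∣ p ∣ → q ⊆ p
p⊆q⇒∣q∣≤∣p∣⇒q⊆p {p = p} p⊆q ∣q∣≤∣p∣ {x} x∈q with x ∈? p
... | yes x∈p = x∈p
... | no x∉p = contradiction (p⊂q⇒∣p∣<∣q∣ (p⊆q , x , x∈q , x∉p)) (≤⇒≯ ∣q∣≤∣p∣)

module _ {P : Subset n → Set} (P? : Decidable P) (w : Subset n → ℕ) where

  argmin : ∀ {p} → P p → ∃ λ q → P q × (∀ {r} → P r → w q ≤ w r)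
  argmin {p} Pp = go Pp (<-wellFounded (w p))
    where
    go : ∀ {p} → P p → Acc _<_ (w p) → ∃ λ q → P q × (∀ {r} → P r → w q ≤ w r)
    go {p} Pp (acc rec) with anySubset? (λ q → P? q ×-dec w q <? w p)
    ... | yes (q , Pq , q<p) = go Pq (rec q<p)
    ... | no ∄ = p , Pp , λ {r} Pr → ≮⇒≥ λ r<p → ∄ (r , Pr , r<p)

-- Equations between words in abelian groups.

-- An equation between words in an abelian group is decided by moving the
-- inverted letters to the other side and comparing in the free commutative monoid.
module AbelianGroupSolver (𝓖 : AbelianGroup 0ℓ 0ℓ) where

  open AbelianGroup 𝓖 hiding (refl; sym; trans)
  private
    module ≈ = AbelianGroup 𝓖
    module CM = CommutativeMonoidSolver commutativeMonoid
  open import Relation.Binary.Reasoning.Setoid setoid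
  open SemigroupProperties commutativeSemigroup using (interchange)
  open GroupProperties group using (∙-cancelʳ)

  infixl 7 _⊙_
  infix 8 _⁻

  data Expr (k : ℕ) : Set where
    var : Fin k → Expr k
    𝟙   : Expr k
    _⊙_ : Expr k → Expr k → Expr k
    _⁻  : Expr k → Expr k

  private variable
    k : ℕ

  ⟦_⟧ : Expr k → CM.Env k → Carrier
  ⟦ var i ⟧ ρ = CM.⟦ CM.var i ⟧ ρ
  ⟦ 𝟙 ⟧ ρ     = ε
  ⟦ a ⊙ b ⟧ ρ = ⟦ a ⟧ ρ ∙ ⟦ b ⟧ ρ
  ⟦ a ⁻ ⟧ ρ   = ⟦ a ⟧ ρ ⁻¹

  num den : Expr k → CM.Expr k
  num (var i) = CM.var i
  num 𝟙       = CM.id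
  num (a ⊙ b) = num a CM.⊕ num b
  num (a ⁻)   = den a
  den (var i) = CM.id
  den 𝟙       = CM.id
  den (a ⊙ b) = den a CM.⊕ den b
  den (a ⁻)   = num a

  num≈den : ∀ (a : Expr k) ρ → ⟦ a ⟧ ρ ∙ CM.⟦ den a ⟧ ρ ≈ CM.⟦ num a ⟧ ρ
  num≈den (var i) ρ = identityʳ _
  num≈den 𝟙 ρ = identityʳ _
  num≈den (a ⊙ b) ρ = ≈.trans (interchange _ _ _ _) (∙-cong (num≈den a ρ) (num≈den b ρ))
  num≈den (a ⁻) ρ = begin
    ⟦ a ⟧ ρ ⁻¹ ∙ CM.⟦ num a ⟧ ρ               ≈⟨ ∙-congˡ (num≈den a ρ) ⟨
    ⟦ a ⟧ ρ ⁻¹ ∙ (⟦ a ⟧ ρ ∙ CM.⟦ den a ⟧ ρ)   ≈⟨ assoc _ _ _ ⟨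
    ⟦ a ⟧ ρ ⁻¹ ∙ ⟦ a ⟧ ρ ∙ CM.⟦ den a ⟧ ρ     ≈⟨ ∙-congʳ (inverseˡ _) ⟩
    ε ∙ CM.⟦ den a ⟧ ρ                        ≈⟨ identityˡ _ ⟩
    CM.⟦ den a ⟧ ρ                            ∎

  infix 4 _≋_
  _≋_ : Expr k → Expr k → Set
  a ≋ b = CM.normalise (num a CM.⊕ den b) ≡ CM.normalise (num b CM.⊕ den a)

  ≋-sound : ∀ (a b : Expr k) → a ≋ b → ∀ ρ → ⟦ a ⟧ ρ ≈ ⟦ b ⟧ ρ
  ≋-sound a b a≋b ρ = ∙-cancelʳ (CM.⟦ den a ⟧ ρ ∙ CM.⟦ den b ⟧ ρ) _ _ (begin
    ⟦ a ⟧ ρ ∙ (CM.⟦ den a ⟧ ρ ∙ CM.⟦ den b ⟧ ρ)  ≈⟨ assoc _ _ _ ⟨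
    ⟦ a ⟧ ρ ∙ CM.⟦ den a ⟧ ρ ∙ CM.⟦ den b ⟧ ρ    ≈⟨ ∙-congʳ (num≈den a ρ) ⟩
    CM.⟦ num a CM.⊕ den b ⟧ ρ                    ≈⟨ correct (num a CM.⊕ den b) ρ ⟨
    CM.⟦ CM.normalise (num a CM.⊕ den b) ⟧⇓ ρ    ≡⟨ cong (λ v → CM.⟦ v ⟧⇓ ρ) a≋b ⟩
    CM.⟦ CM.normalise (num b CM.⊕ den a) ⟧⇓ ρ    ≈⟨ correct (num b CM.⊕ den a) ρ ⟩
    CM.⟦ num b CM.⊕ den a ⟧ ρ                    ≈⟨ ∙-congʳ (num≈den b ρ) ⟨
    ⟦ b ⟧ ρ ∙ CM.⟦ den b ⟧ ρ ∙ CM.⟦ den a ⟧ ρ    ≈⟨ assoc _ _ _ ⟩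
    ⟦ b ⟧ ρ ∙ (CM.⟦ den b ⟧ ρ ∙ CM.⟦ den a ⟧ ρ)  ≈⟨ ∙-congˡ (comm _ _) ⟩
    ⟦ b ⟧ ρ ∙ (CM.⟦ den a ⟧ ρ ∙ CM.⟦ den b ⟧ ρ)  ∎)
    where open import Algebra.Solver.CommutativeMonoid.Normal commutativeMonoid using (correct)

  module _ (k : ℕ) (f : N-ary k (Expr k) (Expr k × Expr k)) where
    private
      sides : Expr k × Expr k
      sides = f $ⁿ Vec.map var (Vec.allFin k)
      lhs = proj₁ sides
      rhs = proj₂ sides

    solve : lhs ≋ rhs → ∀ⁿ k (curryⁿ λ ρ → ⟦ lhs ⟧ ρ ≈ ⟦ rhs ⟧ ρ)
    solve eq = Equivalence.from (uncurry-∀ⁿ k) λ ρ →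
      subst (λ P → P) (sym (left-inverse (λ ρ → ⟦ lhs ⟧ ρ ≈ ⟦ rhs ⟧ ρ) ρ)) (≋-sound lhs rhs eq ρ)

-- Translates, sumsets and subgroups.

module Sumsets {n : ℕ} (G : FinAbGroup n) where

  𝓖 : AbelianGroup 0ℓ 0ℓ
  𝓖 = record { isAbelianGroup = FinAbGroup.isAbelianGroup G }

  open AbelianGroup 𝓖 public using (_∙_; ε; _⁻¹; identityˡ; identityʳ; inverseʳ; inverseˡ; group; monoid)
    renaming (_-_ to infixl 7 _//_)
  open AbelianGroupSolver 𝓖 public using (solve; _⊙_; _⁻; 𝟙)
  open GroupProperties group public using (∙-cancelˡ; ∙-cancelʳ; ⁻¹-injective)
  open MonoidMultiples monoid public using ()
    renaming (_×_ to _·_; ×-homo-+ to ·-homo-+; ×-assocˡ to ·-assocˡ; ×-homo-1 to ·-homo-1)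

  private variable
    x y z a : Fin n
    X Y Z : Subset n

  x//y∙y : ∀ x y → x // y ∙ y ≡ x
  x//y∙y = solve 2 (λ x y → x ⊙ y ⁻ ⊙ y , x) refl

  x∙[y//x] : ∀ x y → x ∙ (y // x) ≡ y
  x∙[y//x] = solve 2 (λ x y → x ⊙ (y ⊙ x ⁻) , y) refl

  [x∙y]//x : ∀ x y → x ∙ y // x ≡ y
  [x∙y]//x = solve 2 (λ x y → x ⊙ y ⊙ x ⁻ , y) refl

  x//x : ∀ x → x // x ≡ ε
  x//x = inverseʳ

  x//[x//y] : ∀ x y → x // (x // y) ≡ y
  x//[x//y] = solve 2 (λ x y → x ⊙ (x ⊙ y ⁻) ⁻ , y) refl

  module _ (a : Fin n) (X : Subset n) where

    shift-dec : Decidable (λ z → z // a ∈ X)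
    shift-dec z = (z // a) ∈? X

    -- The translate a + X, given through z - a so that membership is a single test in X.
    shift : Subset n
    shift = subset shift-dec

  ∈-shift⁺ : z // a ∈ X → z ∈ shift a X
  ∈-shift⁺ {a = a} {X} = ∈-subset⁺ (shift-dec a X)

  ∈-shift⁻ : z ∈ shift a X → z // a ∈ X
  ∈-shift⁻ {a = a} {X} = ∈-subset⁻ (shift-dec a X)

  ∙∈shift : x ∈ X → a ∙ x ∈ shift a X
  ∙∈shift x∈X = ∈-shift⁺ (subst (_∈ _) (sym ([x∙y]//x _ _)) x∈X)

  ∣shift∣ : ∀ a X → ∣ shift a X ∣ ≡ ∣ X ∣
  ∣shift∣ a X = ≤-antisym
    (∣∣-injection (λ {x} {y} → ∙-cancelʳ (a ⁻¹) x y) ∈-shift⁻)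
    (∣∣-injection (λ {x} {y} → ∙-cancelˡ a x y) ∙∈shift)

  module _ (X : Subset n) where

    inverses-dec : Decidable (λ z → z ⁻¹ ∈ X)
    inverses-dec z = (z ⁻¹) ∈? X

    inverses : Subset n
    inverses = subset inverses-dec

  ⁻¹⁻¹ : ∀ x → x ⁻¹ ⁻¹ ≡ x
  ⁻¹⁻¹ = solve 1 (λ x → x ⁻ ⁻ , x) refl

  ∣inverses∣ : ∀ X → ∣ inverses X ∣ ≡ ∣ X ∣
  ∣inverses∣ X = ≤-antisym
    (∣∣-injection ⁻¹-injective (∈-subset⁻ (inverses-dec X)))
    (∣∣-injection ⁻¹-injective λ {x} x∈X → ∈-subset⁺ (inverses-dec X) (subst (_∈ X) (sym (⁻¹⁻¹ x)) x∈X))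



  ⊕-dec : ∀ X Y → Decidable (λ z → ∃ λ x → x ∈ X × z // x ∈ Y)
  ⊕-dec X Y z = Finₚ.any? λ x → x ∈? X ×-dec (z // x) ∈? Y

  infixl 6 _⊕_

  abstract
    _⊕_ : Subset n → Subset n → Subset n
    X ⊕ Y = subset (⊕-dec X Y)

    ∈-⊕⁺ : x ∈ X → y ∈ Y → x ∙ y ∈ X ⊕ Y
    ∈-⊕⁺ {X = X} {Y = Y} x∈X y∈Y =
      ∈-subset⁺ (⊕-dec X Y) (_ , x∈X , subst (_∈ Y) (sym ([x∙y]//x _ _)) y∈Y)

    ∈-⊕⁻ : ∀ X Y → z ∈ X ⊕ Y → ∃₂ λ x y → x ∈ X × y ∈ Y × z ≡ x ∙ y
    ∈-⊕⁻ X Y z∈ = let x , x∈X , z//x∈Y = ∈-subset⁻ (⊕-dec X Y) z∈ in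
      x , _ , x∈X , z//x∈Y , sym (x∙[y//x] x _)

  ⊕-mono : ∀ {X X′ Y Y′} → X ⊆ X′ → Y ⊆ Y′ → X ⊕ Y ⊆ X′ ⊕ Y′
  ⊕-mono {X} {_} {Y} X⊆X′ Y⊆Y′ z∈ with ∈-⊕⁻ X Y z∈
  ... | x , y , x∈X , y∈Y , refl = ∈-⊕⁺ (X⊆X′ x∈X) (Y⊆Y′ y∈Y)

  -- The h-fold sumset hX; the multiple kx of an element is k · x.
  infixr 8 _⊛_
  _⊛_ : ℕ → Subset n → Subset n
  zero ⊛ X  = ⁅ ε ⁆
  suc h ⊛ X = X ⊕ h ⊛ X

  ⊛-mono : ∀ {X Y} h → X ⊆ Y → h ⊛ X ⊆ h ⊛ Y
  ⊛-mono zero X⊆Y z∈ = z∈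
  ⊛-mono (suc h) X⊆Y = ⊕-mono X⊆Y (⊛-mono h X⊆Y)

  ∈-⊛⇒InSumset : ∀ h → z ∈ h ⊛ X → InSumset G h X z
  ∈-⊛⇒InSumset zero z∈ = [] , [] , sym (x∈⁅y⁆⇒x≡y ε z∈)
  ∈-⊛⇒InSumset {X = X} (suc h) z∈ with ∈-⊕⁻ X (h ⊛ X) z∈
  ... | x , y , x∈X , y∈ , refl with ∈-⊛⇒InSumset h y∈
  ... | v , v∈ , refl = x ∷ v , x∈X ∷ v∈ , refl

  InSumset⇒∈-⊛ : ∀ h → InSumset G h X z → z ∈ h ⊛ X
  InSumset⇒∈-⊛ zero ([] , [] , refl) = x∈⁅x⁆ ε
  InSumset⇒∈-⊛ (suc h) (x ∷ v , x∈X ∷ v∈ , refl) = ∈-⊕⁺ x∈X (InSumset⇒∈-⊛ h (v , v∈ , refl))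

  record IsSubgroup (H : Subset n) : Set where
    field
      ε∈  : ε ∈ H
      //∈ : x ∈ H → y ∈ H → x // y ∈ H

    ⁻¹∈ : x ∈ H → x ⁻¹ ∈ H
    ⁻¹∈ x∈ = subst (_∈ H) (identityˡ _) (//∈ ε∈ x∈)

    ∙∈ : x ∈ H → y ∈ H → x ∙ y ∈ H
    ∙∈ x∈ y∈ = subst (_∈ H) (solve 2 (λ x y → x ⊙ y ⁻ ⁻ , x ⊙ y) refl _ _) (//∈ x∈ (⁻¹∈ y∈))

  ⊕-closed : ∀ {M} → IsSubgroup M → X ⊆ M → Y ⊆ M → X ⊕ Y ⊆ M
  ⊕-closed {X} {Y} {M} M≤ X⊆M Y⊆M z∈ with ∈-⊕⁻ X Y z∈
  ... | x , y , x∈X , y∈Y , refl = IsSubgroup.∙∈ M≤ (X⊆M x∈X) (Y⊆M y∈Y)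

  ⊛-closed : ∀ {M} → IsSubgroup M → X ⊆ M → ∀ h → h ⊛ X ⊆ M
  ⊛-closed M≤ X⊆M zero z∈ = subst (_∈ _) (sym (x∈⁅y⁆⇒x≡y ε z∈)) (IsSubgroup.ε∈ M≤)
  ⊛-closed M≤ X⊆M (suc h) = ⊕-closed M≤ X⊆M (⊛-closed M≤ X⊆M h)

  Periodic : Subset n → Subset n → Set
  Periodic H X = ∀ {x η} → x ∈ X → η ∈ H → x ∙ η ∈ X

  -- Removing a coset x + H from X leaves a set that is again closed under adding H, so X is
  -- exhausted coset by coset. For a subgroup X containing H this is Lagrange's theorem.
  periodic⇒∣∣∣ : ∀ {H} → IsSubgroup H → ∀ X → Periodic H X → ∃ λ k → ∣ X ∣ ≡ k * ∣ H ∣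
  periodic⇒∣∣∣ {H} H≤ X per = go X per (<-wellFounded ∣ X ∣)
    where
    open IsSubgroup H≤
    go : ∀ X → Periodic H X → Acc _<_ ∣ X ∣ → ∃ λ k → ∣ X ∣ ≡ k * ∣ H ∣
    go X per (acc rec) with nonempty? X
    ... | no ¬ne = 0 , trans (cong ∣_∣ (Empty-unique ¬ne)) (∣⊥∣≡0 n)
    ... | yes (x , x∈X) = suc k , trans size (cong (∣ H ∣ +_) eq)
      where
      C = shift x H
      C⊆X : C ⊆ X
      C⊆X z∈ = subst (_∈ X) (x∙[y//x] x _) (per x∈X (∈-shift⁻ z∈))
      X′-dec : Decidable (λ z → z ∈ X × z ∉ C)
      X′-dec z = z ∈? X ×-dec ¬? (z ∈? C)
      X′ = subset X′-dec
      size : ∣ X ∣ ≡ ∣ H ∣ + ∣ X′ ∣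
      size = trans (≤-antisym
        (∣cover∣≤ λ {z} z∈X → case (z ∈? C) z∈X)
        (∣⊎∣≤ (λ z∈C z∈X′ → proj₂ (∈-subset⁻ X′-dec z∈X′) z∈C) C⊆X (proj₁ ∘ ∈-subset⁻ X′-dec)))
        (cong (_+ ∣ X′ ∣) (∣shift∣ x H))
        where
        case : Dec (z ∈ C) → z ∈ X → z ∈ C ⊎ z ∈ X′
        case (yes z∈C) _ = inj₁ z∈C
        case (no z∉C) z∈X = inj₂ (∈-subset⁺ X′-dec (z∈X , z∉C))
      per′ : Periodic H X′
      per′ {z} {η} z∈ η∈ = let z∈X , z∉C = ∈-subset⁻ X′-dec z∈ in
        ∈-subset⁺ X′-dec (per z∈X η∈ , λ zη∈ → z∉C (∈-shift⁺ (subst (_∈ H)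
          (solve 3 (λ z η x → z ⊙ η ⊙ x ⁻ ⊙ η ⁻ , z ⊙ x ⁻) refl z η x) (//∈ (∈-shift⁻ zη∈) η∈))))
      ih = go X′ per′ (rec (≤-trans (+-monoˡ-≤ ∣ X′ ∣ (nonempty⇒0<∣∣ ε∈)) (≤-reflexive (sym size))))
      k = proj₁ ih
      eq = proj₂ ih

  ⊕-periodic : ∀ {H} → IsSubgroup H → ∀ X → Periodic H (H ⊕ X)
  ⊕-periodic {H} H≤ X {η = η} z∈ η∈ with ∈-⊕⁻ H X z∈
  ... | η′ , x , η′∈ , x∈ , refl = subst (_∈ H ⊕ X)
    (solve 3 (λ a b x → a ⊙ b ⊙ x , a ⊙ x ⊙ b) refl η′ η x) (∈-⊕⁺ (IsSubgroup.∙∈ H≤ η′∈ η∈) x∈)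

  subgroup-periodic : ∀ {H M} → IsSubgroup M → H ⊆ M → Periodic H M
  subgroup-periodic M≤ H⊆M x∈ η∈ = IsSubgroup.∙∈ M≤ x∈ (H⊆M η∈)

-- Inequalities between cardinalities for the isoperimetric method.

compare-boundaries : ∀ {a b c d x k n} → a + c ≤ b + d → c + k ≡ n → d + x ≡ n → a + x ≤ b + k
compare-boundaries {a} {b} {c} {d} {x} {k} {n} h₁ h₂ h₃ = +-cancelʳ-≤ (c + d) (a + x) (b + k) (begin
  a + x + (c + d)    ≡⟨ solveℕ 4 (λ a x c d → a :+ x :+ (c :+ d) := a :+ c :+ (d :+ x)) refl a x c d ⟩
  a + c + (d + x)    ≤⟨ +-mono-≤ h₁ (≤-reflexive (trans h₃ (sym h₂))) ⟩
  b + d + (c + k)    ≡⟨ solveℕ 4 (λ b d c k → b :+ d :+ (c :+ k) := b :+ k :+ (c :+ d)) refl b d c k ⟩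
  b + k + (c + d)    ∎)
  where open ≤-Reasoning

-- To be read with p, q, r the sizes of I ⊕ A, U ⊕ A, K ⊕ A and i, u, k those of I = K ∩ L, U = K ∪
-- L, K: submodularity and the minimality of K against U make I attain the minimum too.
uncross : ∀ {p q r i u k} → p + q ≤ r + r → i + u ≡ k + k → r + u ≤ q + k → p + k ≤ r + i
uncross {p} {q} {r} {i} {u} {k} h₁ h₂ h₃ = +-cancelʳ-≤ (q + r + u + u) (p + k) (r + i) (begin
  p + k + (q + r + u + u)    ≡⟨ solveℕ 5 (λ p k q r u → p :+ k :+ (q :+ r :+ u :+ u) := p :+ q :+ (r :+ u) :+ (k :+ u)) refl p k q r u ⟩
  p + q + (r + u) + (k + u)  ≤⟨ +-monoˡ-≤ (k + u) (+-mono-≤ h₁ h₃) ⟩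
  r + r + (q + k) + (k + u)  ≡⟨ solveℕ 4 (λ r q k u → r :+ r :+ (q :+ k) :+ (k :+ u) := r :+ r :+ q :+ u :+ (k :+ k)) refl r q k u ⟩
  r + r + q + u + (k + k)    ≡⟨ cong (r + r + q + u +_) h₂ ⟨
  r + r + q + u + (i + u)    ≡⟨ solveℕ 4 (λ r q u i → r :+ r :+ q :+ u :+ (i :+ u) := r :+ i :+ (q :+ r :+ u :+ u)) refl r q u i ⟩
  r + i + (q + r + u + u)    ∎)
  where open ≤-Reasoning

-- The same conclusion when U ⊕ A fills M, so that U is not admissible. Here m = ∣ M ∣, and k + r ≤
-- m replaces minimality against U.
uncross-full : ∀ {p q r m i k} → p + q ≤ r + r → m ≤ q → k + r ≤ m → p + k ≤ r + i
uncross-full {p} {q} {r} {m} {i} {k} h₁ h₂ h₃ = ≤-trans (+-cancelʳ-≤ (q + r) (p + k) r (begin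
  p + k + (q + r)    ≡⟨ solveℕ 4 (λ p k q r → p :+ k :+ (q :+ r) := p :+ q :+ (k :+ r)) refl p k q r ⟩
  p + q + (k + r)    ≤⟨ +-mono-≤ h₁ (≤-trans h₃ h₂) ⟩
  r + r + q          ≡⟨ solveℕ 2 (λ r q → r :+ r :+ q := r :+ (q :+ r)) refl r q ⟩
  r + (q + r)        ∎)) (m≤m+n r i)
  where open ≤-Reasoning

-- The isoperimetric method: atoms containing 0 are subgroups.

module Isoperimetry {n : ℕ} (G : FinAbGroup n) where

  open Sumsets G

  Misses : Subset n → Subset n → Set
  Misses M X = ∃ λ z → z ∈ M × z ∉ X

  misses? : ∀ M X → Dec (Misses M X)
  misses? M X = Finₚ.any? λ z → z ∈? M ×-dec ¬? (z ∈? X)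

  ¬misses⇒⊇ : ∀ {M X} → ¬ Misses M X → M ⊆ X
  ¬misses⇒⊇ {X = X} ¬miss {z} z∈M with z ∈? X
  ... | yes z∈X = z∈X
  ... | no z∉X = contradiction (z , z∈M , z∉X) ¬miss

  module _ (M A : Subset n) where

    Admissible : Subset n → Set
    Admissible X = X ⊆ M × Nonempty X × Misses M (X ⊕ A)

    admissible? : Decidable Admissible
    admissible? X = X ⊆? M ×-dec nonempty? X ×-dec misses? M (X ⊕ A)

    -- Among the admissible sets K has the least value of ∣ K ⊕ A ∣ − ∣ K ∣, and
    -- the least cardinality among those that attain it.
    record IsAtom (K : Subset n) : Set where
      field
        admissible : Admissible K
        least      : ∀ {X} → Admissible X → ∣ K ⊕ A ∣ + ∣ X ∣ ≤ ∣ X ⊕ A ∣ + ∣ K ∣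
        smallest   : ∀ {X} → Admissible X → ∣ X ⊕ A ∣ + ∣ K ∣ ≤ ∣ K ⊕ A ∣ + ∣ X ∣ → ∣ K ∣ ≤ ∣ X ∣

    ∣∁∣+∣∣ : ∀ (X : Subset n) → ∣ ∁ X ∣ + ∣ X ∣ ≡ n
    ∣∁∣+∣∣ X = trans (cong (_+ ∣ X ∣) (∣∁p∣≡n∸∣p∣ X)) (m∸n+n≡m (∣p∣≤n X))

    atom : ∀ {X} → Admissible X → ∃ IsAtom
    atom {X} adm = let
      -- This is ∣ Y ⊕ A ∣ - ∣ Y ∣ raised by the constant n, which keeps the weight a natural
      -- number.
      w = λ Y → ∣ Y ⊕ A ∣ + ∣ ∁ Y ∣
      K₀ , adm₀ , min₀ = argmin admissible? w adm
      K , (admK , wK) , minK = argmin (λ Y → admissible? Y ×-dec w Y ≤? w K₀) ∣_∣ (adm₀ , ≤-refl)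
      in K , record
      { admissible = admK
      ; least = λ {Y} admY → compare-boundaries {∣ K ⊕ A ∣} {∣ Y ⊕ A ∣} (≤-trans wK (min₀ admY)) (∣∁∣+∣∣ K) (∣∁∣+∣∣ Y)
      ; smallest = λ {Y} admY le → minK (admY , ≤-trans
          (compare-boundaries {∣ Y ⊕ A ∣} {∣ K ⊕ A ∣} le (trans (+-comm ∣ K ∣ _) (∣∁∣+∣∣ K)) (trans (+-comm ∣ Y ∣ _) (∣∁∣+∣∣ Y)))
          wK)
      }

  module _ {M A : Subset n} (M≤ : IsSubgroup M) (A⊆M : A ⊆ M) where

    open IsSubgroup M≤

    shift-⊕ : ∀ {g X z} → z ∈ shift g X ⊕ A → z // g ∈ X ⊕ A
    shift-⊕ {g} {X} z∈ with ∈-⊕⁻ (shift g X) A z∈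
    ... | x , a , x∈ , a∈ , refl = subst (_∈ X ⊕ A)
      (solve 3 (λ x a g → x ⊙ g ⁻ ⊙ a , x ⊙ a ⊙ g ⁻) refl x a g) (∈-⊕⁺ (∈-shift⁻ x∈) a∈)

    shift-⊕⁻¹ : ∀ {g X z} → z // g ∈ X ⊕ A → z ∈ shift g X ⊕ A
    shift-⊕⁻¹ {g} {X} {z} z∈ with ∈-⊕⁻ X A z∈
    ... | x , a , x∈ , a∈ , eq = subst (_∈ shift g X ⊕ A)
      (trans (solve 3 (λ g x a → g ⊙ x ⊙ a , g ⊙ (x ⊙ a)) refl g x a) (trans (cong (g ∙_) (sym eq)) (x∙[y//x] g z)))
      (∈-⊕⁺ (∙∈shift x∈) a∈)

    ∣shift⊕∣ : ∀ g X → ∣ shift g X ⊕ A ∣ ≡ ∣ X ⊕ A ∣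
    ∣shift⊕∣ g X = trans (≤-antisym
      (p⊆q⇒∣p∣≤∣q∣ (∈-shift⁺ ∘ shift-⊕))
      (p⊆q⇒∣p∣≤∣q∣ (shift-⊕⁻¹ ∘ ∈-shift⁻))) (∣shift∣ g (X ⊕ A))

    shift-atom : ∀ {g K} → g ∈ M → IsAtom M A K → IsAtom M A (shift g K)
    shift-atom {g} {K} g∈M atomK = record
      { admissible = (λ z∈ → subst (_∈ M) (x//y∙y _ g) (∙∈ (K⊆M (∈-shift⁻ z∈)) g∈M))
                   , (g ∙ proj₁ K≢∅ , ∙∈shift (proj₂ K≢∅))
                   , (z ∙ g , ∙∈ z∈M g∈M , λ zg∈ → z∉ (subst (_∈ K ⊕ A)
                       (solve 2 (λ z g → z ⊙ g ⊙ g ⁻ , z) refl z g) (shift-⊕ zg∈)))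
      ; least = λ {X} admX → subst (λ k → ∣ shift g K ⊕ A ∣ + ∣ X ∣ ≤ ∣ X ⊕ A ∣ + k) (sym (∣shift∣ g K))
          (subst (λ k → k + ∣ X ∣ ≤ ∣ X ⊕ A ∣ + ∣ K ∣) (sym (∣shift⊕∣ g K)) (least admX))
      ; smallest = λ {X} admX le → subst (_≤ ∣ X ∣) (sym (∣shift∣ g K)) (smallest admX
          (subst (λ k → ∣ X ⊕ A ∣ + k ≤ ∣ K ⊕ A ∣ + ∣ X ∣) (∣shift∣ g K)
          (subst (λ k → ∣ X ⊕ A ∣ + ∣ shift g K ∣ ≤ k + ∣ X ∣) (∣shift⊕∣ g K) le)))
      }
      where
      open IsAtom atomK
      K⊆M = proj₁ admissible
      K≢∅ = proj₁ (proj₂ admissible)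
      z = proj₁ (proj₂ (proj₂ admissible))
      z∈M = proj₁ (proj₂ (proj₂ (proj₂ admissible)))
      z∉ = proj₂ (proj₂ (proj₂ (proj₂ admissible)))

    -- The inverse of the complement of K ⊕ A in M attains the minimum as well.
    atom-dual : ∀ {K} → IsAtom M A K → ∣ K ∣ + ∣ K ⊕ A ∣ ≤ ∣ M ∣
    -- With `C` the complement of K ⊕ A in M and `Z` = -C, the set Z ⊕ A avoids -K. Hence ∣ Z ⊕ A ∣
    -- + ∣ K ∣ ≤ ∣ M ∣ ≤ ∣ K ⊕ A ∣ + ∣ Z ∣, and `smallest` gives ∣ K ∣ ≤ ∣ Z ∣ = ∣ C ∣.
    atom-dual {K} atomK = ≤-trans (+-monoˡ-≤ ∣ K ⊕ A ∣ (smallest Z-admissible (begin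
      ∣ Z ⊕ A ∣ + ∣ K ∣           ≡⟨ cong (∣ Z ⊕ A ∣ +_) (∣inverses∣ K) ⟨
      ∣ Z ⊕ A ∣ + ∣ inverses K ∣  ≤⟨ ∣⊎∣≤ disjoint (⊕-closed M≤ Z⊆M A⊆M) inverses⊆M ⟩
      ∣ M ∣                       ≤⟨ ∣cover∣≤ (λ {z} → cover z) ⟩
      ∣ K ⊕ A ∣ + ∣ C ∣           ≡⟨ cong (∣ K ⊕ A ∣ +_) (∣inverses∣ C) ⟨
      ∣ K ⊕ A ∣ + ∣ Z ∣           ∎))) (begin
      ∣ Z ∣ + ∣ K ⊕ A ∣           ≡⟨ cong (_+ ∣ K ⊕ A ∣) (∣inverses∣ C) ⟩
      ∣ C ∣ + ∣ K ⊕ A ∣           ≤⟨ ∣⊎∣≤ (proj₂ ∘ ∈C⁻) (proj₁ ∘ ∈C⁻) (⊕-closed M≤ K⊆M A⊆M) ⟩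
      ∣ M ∣                       ∎)
      where
      open IsAtom atomK
      open ≤-Reasoning
      K⊆M = proj₁ admissible
      x = proj₁ (proj₁ (proj₂ admissible))
      x∈K = proj₂ (proj₁ (proj₂ admissible))
      z₀ = proj₁ (proj₂ (proj₂ admissible))
      C-dec : Decidable (λ z → z ∈ M × z ∉ K ⊕ A)
      C-dec z = z ∈? M ×-dec ¬? (z ∈? (K ⊕ A))
      C = subset C-dec
      ∈C⁻ : ∀ {z} → z ∈ C → z ∈ M × z ∉ K ⊕ A
      ∈C⁻ = ∈-subset⁻ C-dec
      Z = inverses C
      ∈Z⁻ : ∀ {z} → z ∈ Z → z ⁻¹ ∈ C
      ∈Z⁻ = ∈-subset⁻ (inverses-dec C)
      Z⊆M : Z ⊆ M
      Z⊆M z∈ = subst (_∈ M) (⁻¹⁻¹ _) (⁻¹∈ (proj₁ (∈C⁻ (∈Z⁻ z∈))))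
      cover : ∀ z → z ∈ M → z ∈ K ⊕ A ⊎ z ∈ C
      cover z z∈M with z ∈? (K ⊕ A)
      ... | yes z∈ = inj₁ z∈
      ... | no z∉ = inj₂ (∈-subset⁺ C-dec (z∈M , z∉))
      inverses⊆M : inverses K ⊆ M
      inverses⊆M z∈ = subst (_∈ M) (⁻¹⁻¹ _) (⁻¹∈ (K⊆M (∈-subset⁻ (inverses-dec K) z∈)))
      disjoint : Disjoint (Z ⊕ A) (inverses K)
      disjoint w∈ w⁻¹∈K with ∈-⊕⁻ Z A w∈
      ... | z , a , z∈ , a∈ , refl = proj₂ (∈C⁻ (∈Z⁻ z∈)) (subst (_∈ K ⊕ A)
        (solve 2 (λ z a → (z ⊙ a) ⁻ ⊙ a , z ⁻) refl z a) (∈-⊕⁺ (∈-subset⁻ (inverses-dec K) w⁻¹∈K) a∈))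
      Z-admissible : Admissible M A Z
      Z-admissible = Z⊆M
        , (z₀ ⁻¹ , ∈-subset⁺ (inverses-dec C) (subst (_∈ C) (sym (⁻¹⁻¹ z₀))
            (∈-subset⁺ C-dec (proj₂ (proj₂ (proj₂ admissible))))))
        , (x ⁻¹ , ⁻¹∈ (K⊆M x∈K) , λ x⁻¹∈ → disjoint x⁻¹∈
            (∈-subset⁺ (inverses-dec K) (subst (_∈ K) (sym (⁻¹⁻¹ x)) x∈K)))

    -- The intersection of the two atoms is admissible and, by submodularity of X ↦ ∣ X ⊕ A ∣,
    -- attains the minimum. As K is of least cardinality, the intersection is all of K.
    meeting-atoms : ∀ {K L x} → IsAtom M A K → IsAtom M A L → ∣ L ∣ ≡ ∣ K ∣ → ∣ L ⊕ A ∣ ≡ ∣ K ⊕ A ∣ →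
                    x ∈ K → x ∈ L → K ⊆ L
    meeting-atoms {K} {L} {x} atomK atomL ∣L∣ ∣LA∣ x∈K x∈L z∈K =
      proj₂ (x∈p∩q⁻ K L (p⊆q⇒∣q∣≤∣p∣⇒q⊆p (p∩q⊆p K L) (smallest I-admissible I-least) z∈K))
      where
      open IsAtom atomK
      open ≤-Reasoning
      I = K ∩ L
      U = K ∪ L
      I⊕A⊆ : ∀ {z} → z ∈ I ⊕ A → z ∈ (K ⊕ A) ∩ (L ⊕ A)
      I⊕A⊆ z∈ = x∈p∩q⁺ (⊕-mono (p∩q⊆p K L) (λ a∈ → a∈) z∈ , ⊕-mono (p∩q⊆q K L) (λ a∈ → a∈) z∈)
      U⊕A⊆ : ∀ {z} → z ∈ U ⊕ A → z ∈ (K ⊕ A) ∪ (L ⊕ A)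
      U⊕A⊆ z∈ with ∈-⊕⁻ U A z∈
      ... | u , a , u∈ , a∈ , refl with x∈p∪q⁻ K L u∈
      ... | inj₁ u∈K = x∈p∪q⁺ (inj₁ (∈-⊕⁺ u∈K a∈))
      ... | inj₂ u∈L = x∈p∪q⁺ (inj₂ (∈-⊕⁺ u∈L a∈))
      I-admissible : Admissible M A I
      I-admissible = proj₁ admissible ∘ p∩q⊆p K L , (x , x∈p∩q⁺ (x∈K , x∈L)) ,
        (let z , z∈M , z∉ = proj₂ (proj₂ admissible) in z , z∈M , z∉ ∘ ⊕-mono (p∩q⊆p K L) (λ a∈ → a∈))
      submodular : ∣ I ⊕ A ∣ + ∣ U ⊕ A ∣ ≤ ∣ K ⊕ A ∣ + ∣ K ⊕ A ∣
      submodular = begin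
        ∣ I ⊕ A ∣ + ∣ U ⊕ A ∣                                   ≡⟨ +-comm ∣ I ⊕ A ∣ _ ⟩
        ∣ U ⊕ A ∣ + ∣ I ⊕ A ∣                                   ≤⟨ +-mono-≤ (p⊆q⇒∣p∣≤∣q∣ U⊕A⊆) (p⊆q⇒∣p∣≤∣q∣ I⊕A⊆) ⟩
        ∣ (K ⊕ A) ∪ (L ⊕ A) ∣ + ∣ (K ⊕ A) ∩ (L ⊕ A) ∣           ≡⟨ ∣∪∣+∣∩∣ (K ⊕ A) (L ⊕ A) ⟩
        ∣ K ⊕ A ∣ + ∣ L ⊕ A ∣                                   ≡⟨ cong (∣ K ⊕ A ∣ +_) ∣LA∣ ⟩
        ∣ K ⊕ A ∣ + ∣ K ⊕ A ∣                                   ∎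
      ∣I∣+∣U∣ : ∣ I ∣ + ∣ U ∣ ≡ ∣ K ∣ + ∣ K ∣
      ∣I∣+∣U∣ = trans (+-comm ∣ I ∣ ∣ U ∣) (trans (∣∪∣+∣∩∣ K L) (cong (∣ K ∣ +_) ∣L∣))
      U⊆M : U ⊆ M
      U⊆M = [ proj₁ admissible , proj₁ (IsAtom.admissible atomL) ]′ ∘ x∈p∪q⁻ K L
      I-least : ∣ I ⊕ A ∣ + ∣ K ∣ ≤ ∣ K ⊕ A ∣ + ∣ I ∣
      I-least with misses? M (U ⊕ A)
      ... | yes U-misses = uncross {q = ∣ U ⊕ A ∣} {u = ∣ U ∣} submodular ∣I∣+∣U∣
        (least (U⊆M , (x , x∈p∪q⁺ (inj₁ x∈K)) , U-misses))
      -- The union is not admissible here; ∣ K ∣ + ∣ K ⊕ A ∣ ≤ ∣ M ∣ ≤ ∣ U ⊕ A ∣ takes over.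
      ... | no ¬misses = uncross-full submodular (p⊆q⇒∣p∣≤∣q∣ (¬misses⇒⊇ ¬misses)) (atom-dual atomK)

    -- For y ∈ H the atoms H and y + H meet in y, since ε ∈ H. Hence H ⊆ y + H, that is, x - y ∈ H
    -- for every x ∈ H.
    atom-subgroup : ∀ {H} → IsAtom M A H → ε ∈ H → IsSubgroup H
    atom-subgroup {H} atomH ε∈H = record
      { ε∈ = ε∈H
      ; //∈ = λ x∈H y∈H → ∈-shift⁻ (meeting-atoms atomH
          (shift-atom (proj₁ (IsAtom.admissible atomH) y∈H) atomH) (∣shift∣ _ H) (∣shift⊕∣ _ H)
          y∈H (subst (_∈ shift _ H) (identityʳ _) (∙∈shift ε∈H)) x∈H)
      }

    abstract
      subgroup-atom : ∀ {X} → Admissible M A X → ∃ λ H → IsSubgroup H × IsAtom M A H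
      subgroup-atom adm = let
        K , atomK = atom M A adm
        x , x∈K = proj₁ (proj₂ (IsAtom.admissible atomK))
        atomH = shift-atom {x ⁻¹} (⁻¹∈ (proj₁ (IsAtom.admissible atomK) x∈K)) atomK
        in shift (x ⁻¹) K , atom-subgroup atomH (subst (_∈ shift (x ⁻¹) K) (inverseˡ x) (∙∈shift x∈K)) , atomH

-- The upper bound: sets whose sumset misses an element.

module UpperBound {n : ℕ} (G : FinAbGroup n) where

  open Sumsets G
  open Isoperimetry G

  private variable
    x y z a b c g η : Fin n
    X Y Z : Subset n

  ⊛-nonempty : Nonempty X → ∀ j → Nonempty (j ⊛ X)
  ⊛-nonempty X≢∅ zero = ε , x∈⁅x⁆ ε
  ⊛-nonempty X≢∅@(_ , x∈) (suc j) = _ , ∈-⊕⁺ x∈ (proj₂ (⊛-nonempty X≢∅ j))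

  module _ (X : Subset n) (g : Fin n) where

    reflection-dec : Decidable (λ z → g // z ∈ X)
    reflection-dec z = (g // z) ∈? X

    -- The set g - X. Two sets have g in their sumset exactly when one of them meets the reflection
    -- of the other, which turns membership into a pigeonhole question.
    reflection : Subset n
    reflection = subset reflection-dec

  ∈-reflection⁻ : z ∈ reflection X g → g // z ∈ X
  ∈-reflection⁻ {X = X} {g} = ∈-subset⁻ (reflection-dec X g)

  ∣reflection∣ : ∀ X g → ∣ X ∣ ≤ ∣ reflection X g ∣
  ∣reflection∣ X g = ∣∣-injection
    (λ {x} {y} eq → ⁻¹-injective (∙-cancelˡ g (x ⁻¹) (y ⁻¹) eq))
    (λ {x} x∈ → ∈-subset⁺ (reflection-dec X g) (subst (_∈ X) (sym (x//[x//y] g x)) x∈))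

  ⊛-untranslate : ∀ {A₀} B a → (∀ {z} → z ∈ A₀ → z ∙ a ∈ B) → ∀ h → z ∈ h ⊛ A₀ → z ∙ h · a ∈ h ⊛ B
  ⊛-untranslate B a A₀∙a⊆B zero z∈ = subst (_∈ ⁅ ε ⁆) (sym (identityʳ _)) z∈
  ⊛-untranslate {A₀ = A₀} B a A₀∙a⊆B (suc h) z∈ with ∈-⊕⁻ A₀ (h ⊛ A₀) z∈
  ... | u , v , u∈ , v∈ , refl = subst (_∈ suc h ⊛ B)
    (solve 4 (λ u v a t → u ⊙ a ⊙ (v ⊙ t) , u ⊙ v ⊙ (a ⊙ t)) refl u v a (h · a))
    (∈-⊕⁺ (A₀∙a⊆B u∈) (⊛-untranslate B a A₀∙a⊆B h v∈))

  ⊛-coset : ∀ {H} → IsSubgroup H → X ⊆ shift a H → ∀ h → z ∈ h ⊛ X → z // h · a ∈ H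
  ⊛-coset {H = H} H≤ X⊆ zero z∈ = subst (_∈ H)
    (trans (sym (x//x ε)) (cong (_// ε) (sym (x∈⁅y⁆⇒x≡y ε z∈)))) (IsSubgroup.ε∈ H≤)
  ⊛-coset {X} {a} {H = H} H≤ X⊆ (suc h) z∈ with ∈-⊕⁻ X (h ⊛ X) z∈
  ... | u , v , u∈ , v∈ , refl = subst (_∈ H)
    (solve 4 (λ u v a t → u ⊙ a ⁻ ⊙ (v ⊙ t ⁻) , u ⊙ v ⊙ (a ⊙ t) ⁻) refl u v a (h · a))
    (IsSubgroup.∙∈ H≤ (∈-shift⁻ (X⊆ u∈)) (⊛-coset H≤ X⊆ h v∈))

  ⁅ε⁆⊕⊆ : ⁅ ε ⁆ ⊕ X ⊆ X
  ⁅ε⁆⊕⊆ {X} z∈ with ∈-⊕⁻ ⁅ ε ⁆ X z∈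
  ... | e , b , e∈ , b∈ , refl =
    subst (_∈ X) (trans (sym (identityˡ b)) (cong (_∙ b) (sym (x∈⁅y⁆⇒x≡y ε e∈)))) b∈

  -- For any s in h ⊛ A the element y - s is not in A, since otherwise y = (y - s) + s would lie in
  -- suc h ⊛ A.
  ⁅ε⁆-admissible : ∀ h {M A} → IsSubgroup M → A ⊆ M → a ∈ A → y ∈ M → y ∉ suc h ⊛ A → Admissible M A ⁅ ε ⁆
  ⁅ε⁆-admissible {y = y} h {M} {A} M≤ A⊆M a∈A y∈M y∉ =
    (λ z∈ → subst (_∈ M) (sym (x∈⁅y⁆⇒x≡y ε z∈)) M.ε∈) , (ε , x∈⁅x⁆ ε) ,
    (let s , s∈ = ⊛-nonempty (_ , a∈A) h in
     y // s , M.//∈ y∈M (⊛-closed M≤ A⊆M h s∈) ,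
     λ y//s∈ → y∉ (subst (_∈ suc h ⊛ A) (x//y∙y y s) (∈-⊕⁺ (⁅ε⁆⊕⊆ y//s∈) s∈)))
    where module M = IsSubgroup M≤

  -- For positive h the last field says k ≤ ⌊(d - 2) / h⌋, and ∣ L ∣ = ∣ M ∣ / d, so the record
  -- asserts ∣ A ∣ ≤ f_d(∣ M ∣, h) for some divisor d of ∣ M ∣.
  record Bound (h : ℕ) (M A : Subset n) : Set where
    field
      {L}    : Subset n
      {k d}  : ℕ
      L≤     : IsSubgroup L
      ∣M∣    : ∣ M ∣ ≡ d * ∣ L ∣
      ∣A∣    : ∣ A ∣ ≤ suc k * ∣ L ∣
      hk+2≤d : h * k + 2 ≤ d

  module AtomBound {M A H : Subset n} (M≤ : IsSubgroup M) (A⊆M : A ⊆ M) (H≤ : IsSubgroup H)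
    (atomH : IsAtom M A H) (a : Fin n) (a∈A : a ∈ A) where

    private
      module M = IsSubgroup M≤
      module H = IsSubgroup H≤
    open IsAtom atomH

    H⊆M : H ⊆ M
    H⊆M = proj₁ admissible

    H⊕A⊆M : H ⊕ A ⊆ M
    H⊕A⊆M = ⊕-closed M≤ H⊆M A⊆M

    0<∣H∣ : 0 < ∣ H ∣
    0<∣H∣ = nonempty⇒0<∣∣ H.ε∈

    A⊆H⊕A : A ⊆ H ⊕ A
    A⊆H⊕A z∈ = subst (_∈ H ⊕ A) (identityˡ _) (∈-⊕⁺ H.ε∈ z∈)

    coset⊆ : b ∈ A → shift b H ⊆ H ⊕ A
    coset⊆ {b} b∈A z∈ = subst (_∈ H ⊕ A) (x//y∙y _ b) (∈-⊕⁺ (∈-shift⁻ z∈) b∈A)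

    -- The part of H ⊕ A outside one of its cosets. Its size `q` is therefore ∣ H ⊕ A ∣ - ∣ H ∣, the
    -- minimum attained by the atom.
    D : Subset n
    D = (H ⊕ A) ∩ ∁ (shift a H)

    ∈D⁻ : z ∈ D → z ∈ H ⊕ A × z ∉ shift a H
    ∈D⁻ z∈ = let z∈H⊕A , z∈∁ = x∈p∩q⁻ (H ⊕ A) _ z∈ in z∈H⊕A , x∈∁p⇒x∉p z∈∁

    q : ℕ
    q = ∣ D ∣

    ∣H⊕A∣ : ∣ H ⊕ A ∣ ≡ ∣ H ∣ + q
    ∣H⊕A∣ = trans (≤-antisym
      (∣cover∣≤ (λ {z} → cover z))
      (∣⊎∣≤ (λ z∈ z∈D → proj₂ (∈D⁻ z∈D) z∈) (coset⊆ a∈A) (proj₁ ∘ ∈D⁻)))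
      (cong (_+ q) (∣shift∣ a H))
      where
      cover : ∀ z → z ∈ H ⊕ A → z ∈ shift a H ⊎ z ∈ D
      cover z z∈ with z ∈? shift a H
      ... | yes z∈aH = inj₁ z∈aH
      ... | no z∉aH = inj₂ (x∈p∩q⁺ (z∈ , x∉p⇒x∈∁p z∉aH))

    growth : Admissible M A X → ∣ X ∣ + q ≤ ∣ X ⊕ A ∣
    growth {X} adm = +-cancelʳ-≤ ∣ H ∣ _ _ (begin
      ∣ X ∣ + q + ∣ H ∣    ≡⟨ solveℕ 3 (λ x q h → x :+ q :+ h := h :+ q :+ x) refl (∣ X ∣) q (∣ H ∣) ⟩
      ∣ H ∣ + q + ∣ X ∣    ≡⟨ cong (_+ ∣ X ∣) ∣H⊕A∣ ⟨
      ∣ H ⊕ A ∣ + ∣ X ∣    ≤⟨ least adm ⟩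
      ∣ X ⊕ A ∣ + ∣ H ∣    ∎)
      where open ≤-Reasoning

    -- Each further summand A adds at least q elements while the sumset is not all of M. The smaller
    -- sumsets are not full either: if z is missed at one stage, z - a is missed at the stage
    -- before.
    ⊛-growth : ∀ j → Misses M (H ⊕ j ⊛ A) → ∣ H ∣ + j * q ≤ ∣ H ⊕ j ⊛ A ∣
    ⊛-growth zero _ = ≤-trans (≤-reflexive (+-identityʳ _)) (p⊆q⇒∣p∣≤∣q∣ λ {z} z∈ →
      subst (_∈ H ⊕ ⁅ ε ⁆) (identityʳ z) (∈-⊕⁺ z∈ (x∈⁅x⁆ ε)))
    ⊛-growth (suc j) (z , z∈M , z∉) = begin
      ∣ H ∣ + (q + j * q)      ≡⟨ solveℕ 3 (λ h q jq → h :+ (q :+ jq) := h :+ jq :+ q) refl (∣ H ∣) q (j * q) ⟩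
      ∣ H ∣ + j * q + q        ≤⟨ +-monoˡ-≤ q (⊛-growth j S-misses) ⟩
      ∣ S ∣ + q                ≤⟨ growth (⊕-closed M≤ H⊆M (⊛-closed M≤ A⊆M j) , S≢∅ , z , z∈M , z∉ ∘ S⊕A⊆) ⟩
      ∣ S ⊕ A ∣                ≤⟨ p⊆q⇒∣p∣≤∣q∣ S⊕A⊆ ⟩
      ∣ H ⊕ suc j ⊛ A ∣        ∎
      where
      open ≤-Reasoning
      S = H ⊕ j ⊛ A
      S≢∅ : Nonempty S
      S≢∅ = _ , ∈-⊕⁺ H.ε∈ (proj₂ (⊛-nonempty (a , a∈A) j))
      S⊕A⊆ : S ⊕ A ⊆ H ⊕ suc j ⊛ A
      S⊕A⊆ w∈ with ∈-⊕⁻ S A w∈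
      ... | _ , b , x∈ , b∈ , refl with ∈-⊕⁻ H (j ⊛ A) x∈
      ... | η , s , η∈ , s∈ , refl = subst (_∈ H ⊕ suc j ⊛ A)
        (solve 3 (λ η b s → η ⊙ (b ⊙ s) , η ⊙ s ⊙ b) refl η b s) (∈-⊕⁺ η∈ (∈-⊕⁺ b∈ s∈))
      S-misses : Misses M S
      S-misses = z // a , M.//∈ z∈M (A⊆M a∈A) , λ z//a∈ →
        z∉ (S⊕A⊆ (subst (_∈ S ⊕ A) (x//y∙y z a) (∈-⊕⁺ z//a∈ a∈A)))

    part : Fin n → Subset n
    part b = A ∩ shift b H

    ∈shift-self : ∀ b → b ∈ shift b H
    ∈shift-self b = ∈-shift⁺ (subst (_∈ H) (sym (x//x b)) H.ε∈)

    module _ (q<∣A∣ : q < ∣ A ∣) where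

      -- Let R be the part of A outside both cosets. H ⊕ A contains R and both cosets, so 2∣ H ∣ + ∣
      -- R ∣ ≤ ∣ H ∣ + q < ∣ H ∣ + ∣ A ∣, and A is covered by R and the two parts.
      distinct-parts : b ∈ A → c ∈ A → c ∉ shift b H → ∣ H ∣ < ∣ part b ∣ + ∣ part c ∣
      distinct-parts {b} {c} b∈A c∈A c∉ = +-cancelʳ-< (∣ H ∣ + ∣ R ∣) _ _ (begin-strict
        ∣ H ∣ + (∣ H ∣ + ∣ R ∣)                    ≡⟨ +-assoc ∣ H ∣ _ _ ⟨
        ∣ H ∣ + ∣ H ∣ + ∣ R ∣                      ≤⟨ +-monoˡ-≤ ∣ R ∣ 2∣H∣≤∣U∣ ⟩
        ∣ U ∣ + ∣ R ∣                              ≤⟨ ∣⊎∣≤ (λ z∈U z∈R → x∈∁p⇒x∉p (proj₂ (x∈p∩q⁻ A _ z∈R)) z∈U)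
                                                        ([ coset⊆ b∈A , coset⊆ c∈A ]′ ∘ x∈p∪q⁻ (shift b H) _)
                                                        (A⊆H⊕A ∘ p∩q⊆p A _) ⟩
        ∣ H ⊕ A ∣                                  ≡⟨ ∣H⊕A∣ ⟩
        ∣ H ∣ + q                                  <⟨ +-monoʳ-< ∣ H ∣ q<∣A∣ ⟩
        ∣ H ∣ + ∣ A ∣                              ≤⟨ +-monoʳ-≤ ∣ H ∣ (≤-trans (∣cover∣≤ (λ {z} → cover z))
                                                        (+-monoˡ-≤ ∣ R ∣ (∣∪∣≤ (part b) (part c)))) ⟩
        ∣ H ∣ + (∣ part b ∣ + ∣ part c ∣ + ∣ R ∣)  ≡⟨ solveℕ 4 (λ h b c r → h :+ (b :+ c :+ r) := b :+ c :+ (h :+ r)) refl (∣ H ∣) (∣ part b ∣) (∣ part c ∣) (∣ R ∣) ⟩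
        ∣ part b ∣ + ∣ part c ∣ + (∣ H ∣ + ∣ R ∣)  ∎)
        where
        open ≤-Reasoning
        U = shift b H ∪ shift c H
        R = A ∩ ∁ U
        disjoint : Disjoint (shift b H) (shift c H)
        disjoint {z} z∈b z∈c = c∉ (∈-shift⁺ (subst (_∈ H)
          (solve 3 (λ z b c → z ⊙ b ⁻ ⊙ (z ⊙ c ⁻) ⁻ , c ⊙ b ⁻) refl z b c)
          (H.//∈ (∈-shift⁻ z∈b) (∈-shift⁻ z∈c))))
        2∣H∣≤∣U∣ : ∣ H ∣ + ∣ H ∣ ≤ ∣ U ∣
        2∣H∣≤∣U∣ = ≤-trans (≤-reflexive (sym (cong₂ _+_ (∣shift∣ b H) (∣shift∣ c H))))
          (∣⊎∣≤ disjoint (p⊆p∪q _) (q⊆p∪q _ _))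
        cover : ∀ z → z ∈ A → z ∈ part b ∪ part c ⊎ z ∈ R
        cover z z∈A with z ∈? U
        ... | no z∉U = inj₂ (x∈p∩q⁺ (z∈A , x∉p⇒x∈∁p z∉U))
        ... | yes z∈U with x∈p∪q⁻ (shift b H) _ z∈U
        ...   | inj₁ z∈b = inj₁ (x∈p∪q⁺ (inj₁ (x∈p∩q⁺ (z∈A , z∈b))))
        ...   | inj₂ z∈c = inj₁ (x∈p∪q⁺ (inj₂ (x∈p∩q⁺ (z∈A , z∈c))))

      -- Both `part b` and z - `part c` lie in the coset b + H. Together they have more than ∣ H ∣
      -- elements, so they meet.
      large-parts : ∀ b c → ∣ H ∣ < ∣ part b ∣ + ∣ part c ∣ → z ∈ shift (b ∙ c) H → z ∈ A ⊕ A
      large-parts {z} b c large z∈ with nonempty? (part b ∩ reflection (part c) z)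
      ... | yes (w , w∈) = let w∈b , w∈c = x∈p∩q⁻ (part b) _ w∈ in
        subst (_∈ A ⊕ A) (x∙[y//x] w z) (∈-⊕⁺ (p∩q⊆p A _ w∈b) (p∩q⊆p A _ (∈-reflection⁻ w∈c)))
      ... | no empty = contradiction large (≤⇒≯ (begin
        ∣ part b ∣ + ∣ part c ∣                  ≤⟨ +-monoʳ-≤ ∣ part b ∣ (∣reflection∣ (part c) z) ⟩
        ∣ part b ∣ + ∣ reflection (part c) z ∣   ≤⟨ ∣⊎∣≤ (λ {w} w∈b w∈c → empty (w , x∈p∩q⁺ (w∈b , w∈c)))
                                                      (p∩q⊆q A _) reflection⊆ ⟩
        ∣ shift b H ∣                            ≡⟨ ∣shift∣ b H ⟩
        ∣ H ∣                                    ∎))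
        where
        open ≤-Reasoning
        reflection⊆ : reflection (part c) z ⊆ shift b H
        reflection⊆ {w} w∈ = ∈-shift⁺ (subst (_∈ H)
          (solve 4 (λ z w b c → z ⊙ (b ⊙ c) ⁻ ⊙ (z ⊙ w ⁻ ⊙ c ⁻) ⁻ , w ⊙ b ⁻) refl z w b c)
          (H.//∈ (∈-shift⁻ z∈) (∈-shift⁻ (p∩q⊆q A _ (∈-reflection⁻ w∈)))))

      -- The sums of `part b` and `part c` fill the coset b + c + H, which contains η + b′ + c′. So
      -- two elements of A can take up η.
      absorb : ∀ {b c j b′ c′ s} → ∣ H ∣ < ∣ part b ∣ + ∣ part c ∣ → η ∈ H → b′ ∈ shift b H → c′ ∈ shift c H →
               s ∈ j ⊛ A → η ∙ (b′ ∙ (c′ ∙ s)) ∈ suc (suc j) ⊛ A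
      absorb {η} {b} {c} {j} {b′} {c′} {s} large η∈ b′∈ c′∈ s∈
        with ∈-⊕⁻ A A (large-parts {z = η ∙ (b′ ∙ c′)} b c large (∈-shift⁺ (subst (_∈ H)
          (solve 5 (λ η b c b′ c′ → η ⊙ (b′ ⊙ b ⁻ ⊙ (c′ ⊙ c ⁻)) , η ⊙ (b′ ⊙ c′) ⊙ (b ⊙ c) ⁻) refl η b c b′ c′)
          (H.∙∈ η∈ (H.∙∈ (∈-shift⁻ b′∈) (∈-shift⁻ c′∈))))))
      ... | u , v , u∈ , v∈ , eq = subst (_∈ suc (suc j) ⊛ A)
        (trans (trans (solve 3 (λ u v s → u ⊙ (v ⊙ s) , u ⊙ v ⊙ s) refl u v s) (cong (_∙ s) (sym eq)))
          (solve 4 (λ η b c s → η ⊙ (b ⊙ c) ⊙ s , η ⊙ (b ⊙ (c ⊙ s))) refl η b′ c′ s))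
        (∈-⊕⁺ u∈ (∈-⊕⁺ v∈ s∈))

      -- Either all summands can be taken in c + H, or some summand outside is brought to the front,
      -- ready to be paired with c in `absorb`.
      data Spread (c : Fin n) : ℕ → Fin n → Set where
        inside  : ∀ {j s} → s ∈ j ⊛ part c → Spread c j s
        outside : ∀ {j b s} → b ∈ A → b ∉ shift c H → s ∈ j ⊛ A → Spread c (suc j) (b ∙ s)

      spread : ∀ c j {s} → s ∈ j ⊛ A → Spread c j s
      spread c zero s∈ = inside s∈
      spread c (suc j) s∈ with ∈-⊕⁻ A (j ⊛ A) s∈
      ... | b , t , b∈ , t∈ , refl with b ∈? shift c H
      ...   | no b∉ = outside b∈ b∉ t∈
      ...   | yes b∈c with spread c j t∈
      ...     | inside t∈c = inside (∈-⊕⁺ (x∈p∩q⁺ (b∈ , b∈c)) t∈c)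
      ...     | outside {j = i} {b = b′} {s = t′} b′∈ b′∉ t′∈ =
        subst (Spread c (suc j)) (solve 3 (λ b′ b t → b′ ⊙ (b ⊙ t) , b ⊙ (b′ ⊙ t)) refl b′ b t′)
          (outside b′∈ b′∉ (∈-⊕⁺ b∈ t′∈))

      module _ {h y} (y∈M : y ∈ M) (y∉ : y ∉ suc h ⊛ A) where

        -- A summand outside c + H would form with c a pair from distinct cosets. Such a pair
        -- absorbs η, which would put y into suc h ⊛ A.
        monochromatic : ∀ {s} → η ∈ H → c ∈ A → s ∈ h ⊛ A → y ≡ η ∙ (c ∙ s) → s ∈ h ⊛ part c
        monochromatic {c = c} η∈ c∈ s∈ eq with spread c h s∈
        ... | inside s∈c = s∈c
        ... | outside {j = j} {b = b} b∈ b∉ t∈ = contradiction (subst (_∈ suc h ⊛ A) (sym eq)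
          (absorb {b = c} {c = b} {j = j} (distinct-parts c∈ b∈ b∉) η∈ (∈shift-self c) (∈shift-self b) t∈)) y∉

        module _ {s} (η∈ : η ∈ H) (s∈ : s ∈ h ⊛ A) (y≡ : y ≡ η ∙ (a ∙ s)) where

          -- Otherwise all the summands lie in c + H in one case and in a + H in the other, so that
          -- part a and part c have at most |H| / 2 elements each, against distinct-parts.
          unique-coset : ∀ {η′ c s′} → η′ ∈ H → c ∈ A → s′ ∈ h ⊛ A → y ≡ η′ ∙ (c ∙ s′) → c ∈ shift a H
          unique-coset {η′} {c} {s′} η′∈ c∈ s′∈ eq with c ∈? shift a H
          ... | yes c∈aH = c∈aH
          ... | no c∉ = go h refl s∈ s′∈ (monochromatic η∈ a∈A s∈ y≡) (monochromatic η′∈ c∈ s′∈ eq)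
            where
            -- If `part b` had more than ∣ H ∣ / 2 elements, its sums with itself would fill a
            -- coset. The pair formed by b and the first summand of s would then absorb η.
            small : ∀ {η b i s} → y ≡ η ∙ (b ∙ s) → η ∈ H → b ∈ A → h ≡ suc i →
                    s ∈ suc i ⊛ part b → ∣ part b ∣ + ∣ part b ∣ ≤ ∣ H ∣
            small {η} {b} {i} {s} eq η∈ b∈ refl s∈ with ∈-⊕⁻ (part b) (i ⊛ part b) s∈
            ... | b′ , t , b′∈ , t∈ , refl = ≮⇒≥ λ large → y∉ (subst (_∈ suc h ⊛ A) (sym eq)
              (absorb {b = b} {c = b} {j = i} large η∈ (∈shift-self b) (p∩q⊆q A _ b′∈) (⊛-mono i (p∩q⊆p A _) t∈)))
            go : ∀ i → h ≡ i → s ∈ h ⊛ A → s′ ∈ h ⊛ A → s ∈ h ⊛ part a → s′ ∈ h ⊛ part c → c ∈ shift a H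
            -- For h = 0 there is no second summand to feed to `small`. Instead s = s′ = ε, and the
            -- two expressions for y give c - a = η - η′.
            go zero refl s∈ s′∈ _ _ = ∈-shift⁺ (subst (_∈ H) c//a≡ (H.//∈ η∈ η′∈))
              where
              open ≡-Reasoning
              c//a≡ : η // η′ ≡ c // a
              c//a≡ = begin
                η // η′                    ≡⟨ solve 4 (λ η η′ a s → η ⊙ η′ ⁻ , η ⊙ (a ⊙ s) ⊙ (η′ ⊙ a ⊙ s) ⁻) refl η η′ a s ⟩
                η ∙ (a ∙ s) // (η′ ∙ a ∙ s)        ≡⟨ cong (_// (η′ ∙ a ∙ s)) (trans (sym y≡) eq) ⟩
                η′ ∙ (c ∙ s′) // (η′ ∙ a ∙ s)      ≡⟨ cong (λ t → η′ ∙ (c ∙ t) // (η′ ∙ a ∙ s)) (trans (x∈⁅y⁆⇒x≡y ε s′∈) (sym (x∈⁅y⁆⇒x≡y ε s∈))) ⟩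
                η′ ∙ (c ∙ s) // (η′ ∙ a ∙ s)       ≡⟨ solve 4 (λ η′ c a s → η′ ⊙ (c ⊙ s) ⊙ (η′ ⊙ a ⊙ s) ⁻ , c ⊙ a ⁻) refl η′ c a s ⟩
                c // a                     ∎
            go (suc i) refl s∈ s′∈ s∈a s′∈c = contradiction (distinct-parts a∈A c∈ c∉)
              (≤⇒≯ (≮⇒≥ λ large → <⇒≱ (+-mono-< large large) (begin
                ∣ part a ∣ + ∣ part c ∣ + (∣ part a ∣ + ∣ part c ∣)
                  ≡⟨ solveℕ 2 (λ x y → x :+ y :+ (x :+ y) := x :+ x :+ (y :+ y)) refl (∣ part a ∣) (∣ part c ∣) ⟩
                ∣ part a ∣ + ∣ part a ∣ + (∣ part c ∣ + ∣ part c ∣)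
                  ≤⟨ +-mono-≤ (small y≡ η∈ a∈A refl s∈a) (small eq η′∈ c∈ refl s′∈c) ⟩
                ∣ H ∣ + ∣ H ∣ ∎)))
              where open ≤-Reasoning

          -- H + hA and y − D are disjoint, because y has no representation with a summand outside a + H.
          ∣H∣+hq≤∣M∣ : ∣ H ∣ + suc h * q ≤ ∣ M ∣
          ∣H∣+hq≤∣M∣ with nonempty? D
          -- The main case applies `⊛-growth` at a missed element y - w with w in D. For empty D
          -- there is no such w, but q = 0 and H ⊆ M suffices.
          ... | no empty = ≤-trans (≤-reflexive (begin
            ∣ H ∣ + suc h * q    ≡⟨ cong (λ k → ∣ H ∣ + suc h * k) (trans (cong ∣_∣ (Empty-unique empty)) (∣⊥∣≡0 n)) ⟩
            ∣ H ∣ + suc h * 0    ≡⟨ cong (∣ H ∣ +_) (*-zeroʳ (suc h)) ⟩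
            ∣ H ∣ + 0            ≡⟨ +-identityʳ _ ⟩
            ∣ H ∣                ∎)) (p⊆q⇒∣p∣≤∣q∣ H⊆M)
            where open ≡-Reasoning
          ... | yes (w , w∈D) = begin
            ∣ H ∣ + (q + h * q)                ≡⟨ solveℕ 3 (λ h q jq → h :+ (q :+ jq) := h :+ jq :+ q) refl (∣ H ∣) q (h * q) ⟩
            ∣ H ∣ + h * q + q                  ≤⟨ +-mono-≤ (⊛-growth h (y // w , M.//∈ y∈M (H⊕A⊆M (proj₁ (∈D⁻ w∈D))) ,
                                                    λ y//w∈ → disjoint y//w∈ (∈-subset⁺ (reflection-dec D y) (subst (_∈ D) (sym (x//[x//y] y w)) w∈D))))
                                                    (∣reflection∣ D y) ⟩
            ∣ H ⊕ h ⊛ A ∣ + ∣ reflection D y ∣ ≤⟨ ∣⊎∣≤ disjoint (⊕-closed M≤ H⊆M (⊛-closed M≤ A⊆M h)) reflection⊆ ⟩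
            ∣ M ∣                              ∎
            where
            open ≤-Reasoning
            reflection⊆ : reflection D y ⊆ M
            reflection⊆ {z} z∈ = subst (_∈ M) (x//[x//y] y z) (M.//∈ y∈M (H⊕A⊆M (proj₁ (∈D⁻ (∈-reflection⁻ z∈)))))
            disjoint : Disjoint (H ⊕ h ⊛ A) (reflection D y)
            disjoint {z} z∈ z∈r with ∈D⁻ (∈-reflection⁻ {X = D} {y} z∈r) | ∈-⊕⁻ H (h ⊛ A) z∈
            ... | w∈ , w∉ | η₁ , t , η₁∈ , t∈ , refl with ∈-⊕⁻ H A w∈
            ... | η₂ , c , η₂∈ , c∈ , eq = w∉ (∈-shift⁺ (subst (_∈ H)
              (trans (solve 3 (λ η c a → η ⊙ (c ⊙ a ⁻) , η ⊙ c ⊙ a ⁻) refl η₂ c a) (cong (_// a) (sym eq)))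
              (H.∙∈ η₂∈ (∈-shift⁻ (unique-coset (H.∙∈ η₁∈ η₂∈) c∈ t∈ (y≡′))))))
              where
              y≡′ : y ≡ η₁ ∙ η₂ ∙ (c ∙ t)
              y≡′ = trans (trans (sym (x//y∙y y (η₁ ∙ t))) (cong (_∙ (η₁ ∙ t)) eq))
                (solve 4 (λ η₁ η₂ c t → η₂ ⊙ c ⊙ (η₁ ⊙ t) , η₁ ⊙ η₂ ⊙ (c ⊙ t)) refl η₁ η₂ c t)

    -- Minimality of the atom against the singleton of ε; this supplies the strict inequality behind
    -- `distinct-parts`.
    ⁅ε⁆-growth : Admissible M A ⁅ ε ⁆ → q < ∣ A ∣
    ⁅ε⁆-growth adm = begin
      suc q                  ≡⟨ cong (_+ q) (∣⁅x⁆∣≡1 ε) ⟨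
      ∣ ⁅ ε ⁆ ∣ + q          ≤⟨ growth adm ⟩
      ∣ ⁅ ε ⁆ ⊕ A ∣          ≤⟨ p⊆q⇒∣p∣≤∣q∣ ⁅ε⁆⊕⊆ ⟩
      ∣ A ∣                  ∎
      where open ≤-Reasoning

    ∣H∣∣q : ∃ λ k → q ≡ k * ∣ H ∣
    ∣H∣∣q with periodic⇒∣∣∣ H≤ (H ⊕ A) (⊕-periodic H≤ A)
    ... | zero , eq = contradiction 0<∣H∣ (≤⇒≯ (≤-trans (m≤m+n ∣ H ∣ q) (≤-reflexive (trans (sym ∣H⊕A∣) eq))))
    ... | suc k , eq = k , +-cancelˡ-≡ ∣ H ∣ q (k * ∣ H ∣) (trans (sym ∣H⊕A∣) eq)

    module Step {h y} (q<∣A∣ : q < ∣ A ∣) (y∈M : y ∈ M) (y∉ : y ∉ suc h ⊛ A)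
      (k : ℕ) (q≡ : q ≡ k * ∣ H ∣) (d : ℕ) (∣M∣≡ : ∣ M ∣ ≡ d * ∣ H ∣)
      (recurse : ∀ {M′ A′ a′ y′} → IsSubgroup M′ → ∣ M′ ∣ < ∣ M ∣ → A′ ⊆ M′ → a′ ∈ A′ →
               y′ ∈ M′ → y′ ∉ suc h ⊛ A′ → Bound (suc h) M′ A′) where

      open ≤-Reasoning

      cancel-∣H∣ : ∀ {i j} → i * ∣ H ∣ ≤ j * ∣ H ∣ → i ≤ j
      cancel-∣H∣ = *-cancelʳ-≤ _ _ ∣ H ∣ {{>-nonZero 0<∣H∣}}

      -- The coset y + H is disjoint from H ⊕ suc h ⊛ A and contributes one more ∣ H ∣ on top of
      -- `⊛-growth`. This is the second unit in the 2 of the bound, so H itself serves as `L`.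
      coset-missed : y ∉ H ⊕ suc h ⊛ A → Bound (suc h) M A
      coset-missed y∉HhA = record
        { k = k
        ; d = d
        ; L≤ = H≤
        ; ∣M∣ = ∣M∣≡
        ; ∣A∣ = begin
            ∣ A ∣                  ≤⟨ p⊆q⇒∣p∣≤∣q∣ A⊆H⊕A ⟩
            ∣ H ⊕ A ∣              ≡⟨ ∣H⊕A∣ ⟩
            ∣ H ∣ + q              ≡⟨ cong (∣ H ∣ +_) q≡ ⟩
            suc k * ∣ H ∣          ∎
        ; hk+2≤d = cancel-∣H∣ (begin
            (suc h * k + 2) * ∣ H ∣
              ≡⟨ solveℕ 3 (λ h k x → (h :* k :+ con 2) :* x := x :+ h :* (k :* x) :+ x) refl (suc h) k (∣ H ∣) ⟩
            ∣ H ∣ + suc h * (k * ∣ H ∣) + ∣ H ∣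
              ≡⟨ cong₂ (λ s t → ∣ H ∣ + suc h * s + t) (sym q≡) (sym (∣shift∣ y H)) ⟩
            ∣ H ∣ + suc h * q + ∣ shift y H ∣
              ≤⟨ +-monoˡ-≤ _ (⊛-growth (suc h) (y , y∈M , y∉HhA)) ⟩
            ∣ H ⊕ suc h ⊛ A ∣ + ∣ shift y H ∣
              ≤⟨ ∣⊎∣≤ disjoint (⊕-closed M≤ H⊆M (⊛-closed M≤ A⊆M (suc h)))
                   (λ z∈ → subst (_∈ M) (x//y∙y _ y) (M.∙∈ (H⊆M (∈-shift⁻ z∈)) y∈M)) ⟩
            ∣ M ∣
              ≡⟨ ∣M∣≡ ⟩
            d * ∣ H ∣ ∎)
        }
        where
        disjoint : Disjoint (H ⊕ suc h ⊛ A) (shift y H)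
        disjoint {z} z∈ z∈y = y∉HhA (subst (_∈ H ⊕ suc h ⊛ A) (x//[x//y] z y)
          (⊕-periodic H≤ (suc h ⊛ A) z∈ (H.⁻¹∈ (∈-shift⁻ z∈y))))

      module _ {η s} (η∈ : η ∈ H) (s∈ : s ∈ h ⊛ A) (y≡ : y ≡ η ∙ (a ∙ s)) where

        private
          B A₀ : Subset n
          B = part a
          A₀ = shift (a ⁻¹) B

          a∈B : a ∈ B
          a∈B = x∈p∩q⁺ (a∈A , ∈shift-self a)

          A₀∙a⊆B : ∀ {z} → z ∈ A₀ → z ∙ a ∈ B
          A₀∙a⊆B z∈ = subst (_∈ B) (solve 2 (λ z a → z ⊙ a ⁻ ⁻ , z ⊙ a) refl _ a) (∈-shift⁻ z∈)

          A₀⊆H : A₀ ⊆ H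
          A₀⊆H {z} z∈ = subst (_∈ H) (solve 2 (λ z a → z ⊙ a ⊙ a ⁻ , z) refl z a)
            (∈-shift⁻ (p∩q⊆q A _ (A₀∙a⊆B z∈)))

          t = suc h · a

          -- By `monochromatic` all suc h summands of a + s can be taken in a + H. Subtracting a
          -- from each of them, hence `t` from y, leads into H.
          y//t∈H : y // t ∈ H
          y//t∈H = subst (_∈ H)
            (trans (solve 4 (λ η a s t → η ⊙ (a ⊙ s ⊙ t ⁻) , η ⊙ (a ⊙ s) ⊙ t ⁻) refl η a s t) (cong (_// t) (sym y≡)))
            (H.∙∈ η∈ (⊛-coset H≤ (p∩q⊆q A _) (suc h)
              (∈-⊕⁺ a∈B (monochromatic q<∣A∣ {h = h} y∈M y∉ η∈ a∈A s∈ y≡))))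

          y//t∉ : y // t ∉ suc h ⊛ A₀
          y//t∉ y//t∈ = y∉ (⊛-mono (suc h) (p∩q⊆p A _)
            (subst (_∈ suc h ⊛ B) (x//y∙y y t) (⊛-untranslate B a A₀∙a⊆B (suc h) y//t∈)))

          ∣H∣<∣M∣ : ∣ H ∣ < ∣ M ∣
          ∣H∣<∣M∣ = let z , z∈M , z∉ = proj₂ (proj₂ admissible) in
            p⊂q⇒∣p∣<∣q∣ (H⊆M , z // a , M.//∈ z∈M (A⊆M a∈A) ,
              λ z//a∈ → z∉ (subst (_∈ H ⊕ A) (x//y∙y z a) (∈-⊕⁺ z//a∈ a∈A)))

          module IH = Bound (recurse H≤ ∣H∣<∣M∣ A₀⊆H (∙∈shift a∈B) y//t∈H y//t∉)

          1+hk≤d : 1 + suc h * k ≤ d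
          1+hk≤d = cancel-∣H∣ (begin
            (1 + suc h * k) * ∣ H ∣        ≡⟨ solveℕ 3 (λ h k x → (con 1 :+ h :* k) :* x := x :+ h :* (k :* x)) refl (suc h) k (∣ H ∣) ⟩
            ∣ H ∣ + suc h * (k * ∣ H ∣)    ≡⟨ cong (λ s → ∣ H ∣ + suc h * s) q≡ ⟨
            ∣ H ∣ + suc h * q              ≤⟨ ∣H∣+hq≤∣M∣ q<∣A∣ {h = h} y∈M y∉ η∈ s∈ y≡ ⟩
            ∣ M ∣                          ≡⟨ ∣M∣≡ ⟩
            d * ∣ H ∣                      ∎)

          A⊆B∪D : ∀ z → z ∈ A → z ∈ B ⊎ z ∈ D
          A⊆B∪D z z∈ with z ∈? shift a H
          ... | yes z∈aH = inj₁ (x∈p∩q⁺ (z∈ , z∈aH))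
          ... | no z∉aH = inj₂ (x∈p∩q⁺ (A⊆H⊕A z∈ , x∉p⇒x∈∁p z∉aH))

        -- Only 1 + suc h * k ≤ d is available here; the recursive bound with parameters d′, k′ for
        -- `A₀` in H supplies the rest. Since ∣ A ∣ ≤ ∣ A₀ ∣ + k * ∣ H ∣, the new parameters are d *
        -- d′ and k * d′ + k′, and suc h * k′ + 2 ≤ d′ gives suc h * (k * d′ + k′) + 2 ≤ (1 + suc h
        -- * k) * d′ ≤ d * d′.
        coset-met : Bound (suc h) M A
        coset-met = record
          { L≤ = IH.L≤
          ; k = k * IH.d + IH.k
          ; ∣M∣ = trans ∣M∣≡ (trans (cong (d *_) IH.∣M∣) (sym (*-assoc d IH.d ∣ IH.L ∣)))
          ; ∣A∣ = begin
              ∣ A ∣                                          ≤⟨ ∣cover∣≤ (λ {z} → A⊆B∪D z) ⟩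
              ∣ B ∣ + q                                      ≡⟨ cong₂ _+_ (sym (∣shift∣ (a ⁻¹) B)) (trans q≡ (cong (k *_) IH.∣M∣)) ⟩
              ∣ A₀ ∣ + k * (IH.d * ∣ IH.L ∣)                 ≤⟨ +-monoˡ-≤ _ IH.∣A∣ ⟩
              suc IH.k * ∣ IH.L ∣ + k * (IH.d * ∣ IH.L ∣)    ≡⟨ solveℕ 4 (λ j k e l → (con 1 :+ j) :* l :+ k :* (e :* l) := (con 1 :+ (k :* e :+ j)) :* l) refl IH.k k IH.d (∣ IH.L ∣) ⟩
              suc (k * IH.d + IH.k) * ∣ IH.L ∣               ∎
          ; hk+2≤d = begin
              suc h * (k * IH.d + IH.k) + 2                  ≡⟨ solveℕ 4 (λ h k e j → h :* (k :* e :+ j) :+ con 2 := h :* j :+ con 2 :+ h :* k :* e) refl (suc h) k IH.d IH.k ⟩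
              suc h * IH.k + 2 + suc h * k * IH.d            ≤⟨ +-monoˡ-≤ _ IH.hk+2≤d ⟩
              (1 + suc h * k) * IH.d                         ≤⟨ *-monoˡ-≤ IH.d 1+hk≤d ⟩
              d * IH.d                                       ∎
          }

  upperBound : ∀ h {M} → IsSubgroup M → Acc _<_ ∣ M ∣ → ∀ {A} → A ⊆ M → a ∈ A → y ∈ M → y ∉ suc h ⊛ A →
               Bound (suc h) M A
  upperBound {y = y} h {M} M≤ (acc rec) {A} A⊆M a∈A y∈M y∉
    with ⁅ε⁆-adm ← ⁅ε⁆-admissible h M≤ A⊆M a∈A y∈M y∉
    with H , H≤ , atomH ← subgroup-atom M≤ A⊆M ⁅ε⁆-adm
    with d , ∣M∣≡ ← periodic⇒∣∣∣ H≤ M (subgroup-periodic M≤ (proj₁ (IsAtom.admissible atomH)))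
    with y ∈? (H ⊕ suc h ⊛ A)
  ... | no y∉HhA =
    let open AtomBound M≤ A⊆M H≤ atomH _ a∈A
        k , q≡ = ∣H∣∣q
    in Step.coset-missed {h = h} (⁅ε⁆-growth ⁅ε⁆-adm) y∈M y∉ k q≡ d ∣M∣≡
         (λ M′≤ lt → upperBound h M′≤ (rec lt)) y∉HhA
  ... | yes y∈HhA with ∈-⊕⁻ H (suc h ⊛ A) y∈HhA
  ... | η , w , η∈ , w∈ , eq with ∈-⊕⁻ A (h ⊛ A) w∈
  ... | b , s , b∈ , s∈ , refl =
    -- The base point is the first summand of this representation of y modulo H, so the recursion
    -- takes place in the coset that represents y.
    let open AtomBound M≤ A⊆M H≤ atomH b b∈
        k , q≡ = ∣H∣∣q
    in Step.coset-met {h = h} (⁅ε⁆-growth ⁅ε⁆-adm) y∈M y∉ k q≡ d ∣M∣≡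
         (λ M′≤ lt → upperBound h M′≤ (rec lt)) η∈ s∈ eq

-- Cyclic extensions of subgroups and Cauchy's theorem.

module Extensions {n : ℕ} (G : FinAbGroup n) where

  open Sumsets G
  open Isoperimetry G
  open import Algebra.Properties.CommutativeMonoid.Mult (AbelianGroup.commutativeMonoid 𝓖) using ()
    renaming (×-distrib-+ to ·-distrib-∙)

  private variable
    x y z g : Fin n
    K : Subset n

  ⊤-subgroup : IsSubgroup ⊤
  ⊤-subgroup = record { ε∈ = ∈⊤ ; //∈ = λ _ _ → ∈⊤ }

  abstract
    lagrange : IsSubgroup K → ∃ λ d → n ≡ d * ∣ K ∣
    lagrange {K} K≤ = let d , eq = periodic⇒∣∣∣ K≤ ⊤ (λ _ _ → ∈⊤) in d , trans (sym (∣⊤∣≡n n)) eq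

  ·∈ : IsSubgroup K → ∀ k → x ∈ K → k · x ∈ K
  ·∈ K≤ zero x∈ = IsSubgroup.ε∈ K≤
  ·∈ K≤ (suc k) x∈ = IsSubgroup.∙∈ K≤ x∈ (·∈ K≤ k x∈)

  ·-∸ : ∀ {i j} g → i ≤ j → (j ∸ i) · g ≡ j · g // i · g
  ·-∸ {i} {j} g i≤j = begin
    (j ∸ i) · g                      ≡⟨ [x∙y]//x (i · g) _ ⟨
    i · g ∙ (j ∸ i) · g // i · g     ≡⟨ cong (_// i · g) (·-homo-+ g i (j ∸ i)) ⟨
    (i + (j ∸ i)) · g // i · g       ≡⟨ cong (λ k → k · g // i · g) (m+[n∸m]≡n i≤j) ⟩
    j · g // i · g                   ∎
    where open ≡-Reasoning

  -- Pigeonhole on the n + 1 multiples i · g with i ≤ n.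
  torsion : ∀ g → ∃ λ m → 0 < m × m · g ≡ ε
  torsion g with i , j , i<j , eq ← Finₚ.pigeonhole ≤-refl (λ (i : Fin (suc n)) → Fin.toℕ i · g) =
    Fin.toℕ j ∸ Fin.toℕ i , m<n⇒0<n∸m i<j ,
    trans (·-∸ g (<⇒≤ i<j)) (trans (cong (_// Fin.toℕ i · g) (sym eq)) (x//x _))

  -- For a subgroup K, the order of g in the quotient by K.
  record Order (K : Subset n) (g : Fin n) (m : ℕ) : Set where
    field
      positive : 0 < m
      ·∈K      : m · g ∈ K
      minimal  : ∀ {i} → 0 < i → i < m → i · g ∉ K

    instance
      m≢0 : NonZero m
      m≢0 = >-nonZero positive

  abstract
    order : IsSubgroup K → ∀ g → ∃ (Order K g)
    order {K} K≤ g = let m , 0<m , eq = torsion g in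
      go m (<-wellFounded m) 0<m (subst (_∈ K) (sym eq) (IsSubgroup.ε∈ K≤))
      where
      go : ∀ m → Acc _<_ m → 0 < m → m · g ∈ K → ∃ (Order K g)
      go m (acc rec) 0<m m∈ with anyUpTo? (λ i → 0 <? i ×-dec (i · g) ∈? K) m
      ... | yes (i , i<m , 0<i , i∈) = go i (rec i<m) 0<i i∈
      ... | no ∄ = m , record { positive = 0<m ; ·∈K = m∈ ; minimal = λ 0<i i<m i∈ → ∄ (_ , i<m , 0<i , i∈) }

  module _ (K : Subset n) (g : Fin n) where

    cosets : ℕ → Subset n
    cosets zero = ⊥
    cosets (suc q) = cosets q ∪ shift (q · g) K

    ∈-cosets⁺ : ∀ {i q} → i < q → z // i · g ∈ K → z ∈ cosets q
    ∈-cosets⁺ {i = i} {suc q} i<1+q z∈ with m<1+n⇒m<n∨m≡n i<1+q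
    ... | inj₁ i<q = x∈p∪q⁺ (inj₁ (∈-cosets⁺ i<q z∈))
    ... | inj₂ refl = x∈p∪q⁺ (inj₂ (∈-shift⁺ z∈))

    ∈-cosets⁻ : ∀ q → z ∈ cosets q → ∃ λ i → i < q × z // i · g ∈ K
    ∈-cosets⁻ zero z∈ = contradiction z∈ ∉⊥
    ∈-cosets⁻ (suc q) z∈ with x∈p∪q⁻ (cosets q) _ z∈
    ... | inj₂ z∈q = q , ≤-refl , ∈-shift⁻ z∈q
    ... | inj₁ z∈′ with i , i<q , z∈i ← ∈-cosets⁻ q z∈′ = i , m<n⇒m<1+n i<q , z∈i

    ∣cosets∣≤ : ∀ q → ∣ cosets q ∣ ≤ q * ∣ K ∣
    ∣cosets∣≤ zero = ≤-reflexive (∣⊥∣≡0 n)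
    ∣cosets∣≤ (suc q) = begin
      ∣ cosets q ∪ shift (q · g) K ∣        ≤⟨ ∣∪∣≤ (cosets q) _ ⟩
      ∣ cosets q ∣ + ∣ shift (q · g) K ∣    ≤⟨ +-mono-≤ (∣cosets∣≤ q) (≤-reflexive (∣shift∣ (q · g) K)) ⟩
      q * ∣ K ∣ + ∣ K ∣                     ≡⟨ +-comm (q * ∣ K ∣) ∣ K ∣ ⟩
      ∣ K ∣ + q * ∣ K ∣                     ∎
      where open ≤-Reasoning

  module Extension {K m} (K≤ : IsSubgroup K) {g} (ord : Order K g m) where

    open Order ord
    private
      module K = IsSubgroup K≤

    cosets-disjoint : ∀ {q} → q < m → Disjoint (cosets K g q) (shift (q · g) K)
    cosets-disjoint {q} q<m {z} z∈ z∈q with i , i<q , z∈i ← ∈-cosets⁻ K g q z∈ =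
      minimal (m<n⇒0<n∸m i<q) (≤-<-trans (m∸n≤m q i) q<m) (subst (_∈ K)
        (trans (solve 3 (λ z i q → z ⊙ i ⁻ ⊙ (z ⊙ q ⁻) ⁻ , q ⊙ i ⁻) refl z (i · g) (q · g)) (sym (·-∸ g (<⇒≤ i<q))))
        (K.//∈ z∈i (∈-shift⁻ z∈q)))

    ∣cosets∣ : ∀ {q} → q ≤ m → ∣ cosets K g q ∣ ≡ q * ∣ K ∣
    ∣cosets∣ {q} q≤m = ≤-antisym (∣cosets∣≤ K g q) (go q q≤m)
      where
      open ≤-Reasoning
      go : ∀ q → q ≤ m → q * ∣ K ∣ ≤ ∣ cosets K g q ∣
      go zero _ = z≤n
      go (suc q) q<m = begin
        ∣ K ∣ + q * ∣ K ∣                         ≡⟨ +-comm ∣ K ∣ (q * ∣ K ∣) ⟩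
        q * ∣ K ∣ + ∣ K ∣                         ≤⟨ +-mono-≤ (go q (<⇒≤ q<m)) (≤-reflexive (sym (∣shift∣ (q · g) K))) ⟩
        ∣ cosets K g q ∣ + ∣ shift (q · g) K ∣    ≤⟨ ∣⊎∣≤ (cosets-disjoint q<m) (p⊆p∪q _) (q⊆p∪q (cosets K g q) _) ⟩
        ∣ cosets K g (suc q) ∣                    ∎

    -- The subgroup generated by K and g: as m · g ∈ K, the multiples of g below m meet every coset
    -- involved.
    extension : Subset n
    extension = cosets K g m

    remainder : ∀ {i} → z // i · g ∈ K → z // (i % m) · g ∈ K
    remainder {z} {i} z∈ = subst (_∈ K) eq (K.∙∈ z∈ (·∈ K≤ (i / m) ·∈K))
      where
      open ≡-Reasoning
      eq : z // i · g ∙ (i / m) · (m · g) ≡ z // (i % m) · g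
      eq = begin
        z // i · g ∙ (i / m) · (m · g)
          ≡⟨ cong₂ (λ a b → z // a ∙ b)
               (trans (cong (_· g) (m≡m%n+[m/n]*n i m)) (·-homo-+ g (i % m) (i / m * m))) (·-assocˡ g (i / m) m) ⟩
        z // ((i % m) · g ∙ (i / m * m) · g) ∙ (i / m * m) · g
          ≡⟨ solve 3 (λ z a b → z ⊙ (a ⊙ b) ⁻ ⊙ b , z ⊙ a ⁻) refl z ((i % m) · g) ((i / m * m) · g) ⟩
        z // (i % m) · g ∎

    ∈-extension⁺ : ∀ i → z // i · g ∈ K → z ∈ extension
    ∈-extension⁺ i z∈ = ∈-cosets⁺ K g (m%n<n i m) (remainder {i = i} z∈)

    K⊆extension : K ⊆ extension
    K⊆extension z∈ = ∈-extension⁺ 0 (K.//∈ z∈ K.ε∈)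

    g∈extension : g ∈ extension
    g∈extension = ∈-extension⁺ 1 (subst (_∈ K) (sym (trans (cong (g //_) (·-homo-1 g)) (x//x g))) K.ε∈)

    extension-subgroup : IsSubgroup extension
    extension-subgroup = record { ε∈ = K⊆extension K.ε∈ ; //∈ = //∈ }
      where
      //∈ : ∀ {x y} → x ∈ extension → y ∈ extension → x // y ∈ extension
      //∈ {x} {y} x∈ y∈ with i , _ , x∈i ← ∈-cosets⁻ K g m x∈ with j , j<m , y∈j ← ∈-cosets⁻ K g m y∈ =
        -- Multiples are indexed by naturals, so -j · g is replaced by (m ∸ j) · g, which differs
        -- from it by m · g ∈ K.
        ∈-extension⁺ (i + (m ∸ j)) (subst (_∈ K) eq (K.//∈ (K.//∈ x∈i y∈j) ·∈K))
        where
        open ≡-Reasoning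
        eq : x // i · g // (y // j · g) // m · g ≡ x // y // (i + (m ∸ j)) · g
        eq = begin
          x // i · g // (y // j · g) // m · g
            ≡⟨ solve 5 (λ x y i j m → x ⊙ i ⁻ ⊙ (y ⊙ j ⁻) ⁻ ⊙ m ⁻ , x ⊙ y ⁻ ⊙ (i ⊙ (m ⊙ j ⁻)) ⁻) refl x y (i · g) (j · g) (m · g) ⟩
          x // y // (i · g ∙ (m · g // j · g))
            ≡⟨ cong (λ a → x // y // (i · g ∙ a)) (·-∸ g (<⇒≤ j<m)) ⟨
          x // y // (i · g ∙ (m ∸ j) · g)
            ≡⟨ cong (x // y //_) (·-homo-+ g i (m ∸ j)) ⟨
          x // y // (i + (m ∸ j)) · g ∎

    ∣extension∣ : ∣ extension ∣ ≡ m * ∣ K ∣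
    ∣extension∣ = ∣cosets∣ ≤-refl

    order-∣ : ∀ {i} → i · g ∈ K → m ∣ i
    order-∣ {i} i∈ with i % m in eq
    ... | zero = m%n≡0⇒n∣m i m eq
    ... | suc r = contradiction (subst (_∈ K) (solve 1 (λ a → (𝟙 ⊙ a ⁻) ⁻ , a) refl _) (K.⁻¹∈
          (subst (λ k → ε // k · g ∈ K) eq (remainder {z = ε} {i = i} (K.//∈ K.ε∈ i∈)))))
        (minimal (s≤s z≤n) (subst (_< m) eq (m%n<n i m)))

    -- Modulo K the element x is a multiple i · g, and m · (i · g) = i · (m · g).
    m·∈ : ∀ {x} → x ∈ extension → m · x ∈ K
    m·∈ {x} x∈ with i , _ , x∈i ← ∈-cosets⁻ K g m x∈ = subst (_∈ K) eq (K.∙∈ (·∈ K≤ m x∈i) (·∈ K≤ i ·∈K))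
      where
      open ≡-Reasoning
      eq : m · (x // i · g) ∙ i · (m · g) ≡ m · x
      eq = begin
        m · (x // i · g) ∙ i · (m · g)   ≡⟨ cong (m · (x // i · g) ∙_) (trans (·-assocˡ g i m) (trans (cong (_· g) (*-comm i m)) (sym (·-assocˡ g m i)))) ⟩
        m · (x // i · g) ∙ m · (i · g)   ≡⟨ ·-distrib-∙ _ _ m ⟨
        m · (x // i · g ∙ i · g)         ≡⟨ cong (m ·_) (x//y∙y x (i · g)) ⟩
        m · x                            ∎

    g∉K⇒1<m : g ∉ K → 1 < m
    g∉K⇒1<m g∉ = ≤∧≢⇒< positive λ { refl → g∉ (subst (_∈ K) (·-homo-1 g) ·∈K) }

    ∣K∣<∣extension∣ : g ∉ K → ∣ K ∣ < ∣ extension ∣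
    ∣K∣<∣extension∣ g∉ = p⊂q⇒∣p∣<∣q∣ (K⊆extension , g , g∈extension , g∉)

  -- Cauchy's theorem in the quotient by K, by induction on its order d. Let g ∉ K have order m
  -- modulo K. If m = j * p, then j · g works. Otherwise p divides the index d / m of the extension
  -- by g; an element y′ found there gives m · y′, because m maps the extension into K.
  cauchy : ∀ {p} → Prime p → ∀ d → Acc _<_ d → ∀ {K} → IsSubgroup K → n ≡ d * ∣ K ∣ → p ∣ d →
           ∃ λ y → y ∉ K × p · y ∈ K
  cauchy {p} pp d (acc rec) {K} K≤ n≡ p∣d with misses? ⊤ K
  ... | no ¬miss = contradiction (subst Prime (∣1⇒≡1 (subst (p ∣_) d≡1 p∣d)) pp) ¬prime[1]
    where
    ∣K∣≡n : ∣ K ∣ ≡ n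
    ∣K∣≡n = ≤-antisym (∣p∣≤n K) (≤-trans (≤-reflexive (sym (∣⊤∣≡n n))) (p⊆q⇒∣p∣≤∣q∣ (¬misses⇒⊇ ¬miss)))
    d≡1 : d ≡ 1
    d≡1 = *-cancelʳ-≡ d 1 ∣ K ∣ {{>-nonZero (nonempty⇒0<∣∣ (IsSubgroup.ε∈ K≤))}}
      (trans (sym n≡) (trans (sym ∣K∣≡n) (sym (+-identityʳ _))))
  ... | yes (g , _ , g∉) with m , ord ← order K≤ g with p ∣? m
  ...   | yes (divides j refl) = j · g ,
          Order.minimal ord (>-nonZero⁻¹ j {{m*n≢0⇒m≢0 j {{Order.m≢0 ord}}}})
            (m<m*n j p {{m*n≢0⇒m≢0 j {{Order.m≢0 ord}}}} (nonTrivial⇒n>1 p {{prime⇒nonTrivial pp}})) ,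
          subst (_∈ K) (sym (trans (·-assocˡ g p j) (cong (_· g) (*-comm p j)))) (Order.·∈K ord)
  ...   | no p∤m = m · y′ , m·y′∉ , p·m·y′∈
    where
    open Extension K≤ ord
    d′ = proj₁ (lagrange extension-subgroup)
    n≡′ : n ≡ d′ * ∣ extension ∣
    n≡′ = proj₂ (lagrange extension-subgroup)
    0<∣K∣ : 0 < ∣ K ∣
    0<∣K∣ = nonempty⇒0<∣∣ (IsSubgroup.ε∈ K≤)
    d≡ : d ≡ d′ * m
    d≡ = *-cancelʳ-≡ d (d′ * m) ∣ K ∣ {{>-nonZero 0<∣K∣}}
      (trans (sym n≡) (trans n≡′ (trans (cong (d′ *_) ∣extension∣) (sym (*-assoc d′ m ∣ K ∣)))))
    0<n : 0 < n
    0<n = ≤-trans 0<∣K∣ (∣p∣≤n K)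
    0<d′ : 0 < d′
    0<d′ = n≢0⇒n>0 λ { d′≡0 → <⇒≢ 0<n (sym (trans n≡′ (cong (_* ∣ extension ∣) d′≡0))) }
    d′<d : d′ < d
    d′<d = subst (d′ <_) (sym d≡) (m<m*n d′ m {{>-nonZero 0<d′}} (g∉K⇒1<m g∉))
    p∣d′ : p ∣ d′
    p∣d′ with euclidsLemma d′ m pp (subst (p ∣_) d≡ p∣d)
    ... | inj₁ p∣d′ = p∣d′
    ... | inj₂ p∣m = contradiction p∣m p∤m
    ih = cauchy pp d′ (rec d′<d) extension-subgroup n≡′ p∣d′
    y′ = proj₁ ih
    y′∉ = proj₁ (proj₂ ih)
    p·y′∈ = proj₂ (proj₂ ih)
    p·m·y′∈ : p · (m · y′) ∈ K
    p·m·y′∈ = subst (_∈ K) (trans (·-assocˡ y′ m p) (trans (cong (_· y′) (*-comm m p)) (sym (·-assocˡ y′ p m)))) (m·∈ p·y′∈)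
    m·y′∉ : m · y′ ∉ K
    -- Modulo the extension y′ has order exactly p, so m · y′ ∈ K would force p ∣ m.
    m·y′∉ m·y′∈ with o , ord′ ← order extension-subgroup y′
      with prime⇒irreducible pp (Extension.order-∣ extension-subgroup ord′ p·y′∈)
    ... | inj₁ refl = y′∉ (subst (_∈ extension) (·-homo-1 y′) (Order.·∈K ord′))
    ... | inj₂ refl = p∤m (Extension.order-∣ extension-subgroup ord′ (K⊆extension m·y′∈))

-- The lower bound: subgroups of given order and sets with small sumsets.

module LowerBound {n : ℕ} (G : FinAbGroup n) where

  open Sumsets G
  open Isoperimetry G
  open Extensions G

  0<∣subgroup∣ : ∀ {K} → IsSubgroup K → 0 < ∣ K ∣
  0<∣subgroup∣ K≤ = nonempty⇒0<∣∣ (IsSubgroup.ε∈ K≤)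

  ⁅ε⁆-subgroup : IsSubgroup ⁅ ε ⁆
  ⁅ε⁆-subgroup = record
    { ε∈ = x∈⁅x⁆ ε
    ; //∈ = λ x∈ y∈ → subst (_∈ ⁅ ε ⁆)
        (trans (sym (x//x ε)) (cong₂ _//_ (sym (x∈⁅y⁆⇒x≡y ε x∈)) (sym (x∈⁅y⁆⇒x≡y ε y∈)))) (x∈⁅x⁆ ε)
    }

  -- Each prime p yields an element outside K with p-th multiple in K. Its order modulo K divides p
  -- and is not 1, so adjoining it multiplies the cardinality by p.
  climb-primes : ∀ ps → List.All Prime ps → ∀ {K} → IsSubgroup K → product ps * ∣ K ∣ ∣ n →
                 ∃ λ H → IsSubgroup H × ∣ H ∣ ≡ product ps * ∣ K ∣
  climb-primes [] List.[] {K} K≤ _ = K , K≤ , sym (+-identityʳ _)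
  climb-primes (p ∷ ps) (pp List.∷ pps) {K} K≤ (divides c n≡)
    with y , y∉ , p·y∈ ← cauchy pp (c * product ps * p) (<-wellFounded _) K≤
           (trans n≡ (solveℕ 4 (λ c p P k → c :* (p :* P :* k) := c :* P :* p :* k) refl c p (product ps) (∣ K ∣)))
           (n∣m*n (c * product ps))
    with o , ord ← order K≤ y
    with prime⇒irreducible pp (Extension.order-∣ K≤ ord p·y∈)
  ... | inj₁ refl = contradiction (Extension.g∉K⇒1<m K≤ ord y∉) (<-irrefl refl)
  ... | inj₂ refl =
    let open Extension K≤ ord
        eq = trans (cong (product ps *_) ∣extension∣)
               (solveℕ 3 (λ P p k → P :* (p :* k) := p :* P :* k) refl (product ps) p (∣ K ∣))
        H , H≤ , ∣H∣ = climb-primes ps pps extension-subgroup (divides c (trans n≡ (cong (c *_) (sym eq))))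
    in H , H≤ , trans ∣H∣ eq

  subgroup-of-order : ∀ m .{{_ : NonZero m}} → m ∣ n → ∃ λ H → IsSubgroup H × ∣ H ∣ ≡ m
  subgroup-of-order m m∣n =
    let H , H≤ , ∣H∣ = climb-primes factors factorsPrime ⁅ε⁆-subgroup (subst (_∣ n) (sym eq) m∣n)
    in H , H≤ , trans ∣H∣ eq
    where
    open PrimeFactorisation (factorise m)
    eq : product factors * ∣ ⁅ ε ⁆ ∣ ≡ m
    eq = trans (cong (product factors *_) (∣⁅x⁆∣≡1 ε)) (trans (*-identityʳ _) (sym isFactorisation))

  -- Elements of A are adjoined while one is missing, and the subgroup grows strictly each time.
  -- With A = `⊤` this climbs to the whole group; for general A it reaches the generated subgroup.
  subgroup-induction : ∀ A (P : Subset n → Set) →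
    (∀ {K m g} (K≤ : IsSubgroup K) (ord : Order K g m) → g ∈ A → P K → P (Extension.extension K≤ ord)) →
    ∀ {K} → IsSubgroup K → P K → ∃ λ M → IsSubgroup M × A ⊆ M × P M
  subgroup-induction A P step K≤ PK = go K≤ PK (<-wellFounded _)
    where
    go : ∀ {K} → IsSubgroup K → P K → Acc _<_ (n ∸ ∣ K ∣) → ∃ λ M → IsSubgroup M × A ⊆ M × P M
    go {K} K≤ PK (acc rec) with misses? A K
    ... | no ¬miss = K , K≤ , ¬misses⇒⊇ ¬miss , PK
    ... | yes (g , g∈A , g∉) with m , ord ← order K≤ g =
      go extension-subgroup (step K≤ ord g∈A PK) (rec (∸-monoʳ-< (∣K∣<∣extension∣ g∉) (∣p∣≤n extension)))
      where open Extension K≤ ord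

  module _ (h : ℕ) (H : Subset n) where

    -- Each `segment` imitates the interval {0, ..., r} of integers, whose h-fold sumset {0, ...,
    -- hr} has hr + 1 elements, with cosets of H in the role of points.
    record Segments (K : Subset n) : Set where
      field
        index   : ℕ
        ∣K∣     : ∣ K ∣ ≡ index * ∣ H ∣
        segment : ∀ {r} → r < index →
                  ∃ λ I → I ⊆ K × ∣ I ∣ ≡ suc r * ∣ H ∣ × ∣ h ⊛ I ∣ ≤ suc (h * r) * ∣ H ∣

    segments-base : IsSubgroup H → Segments H
    segments-base H≤ = record
      { index = 1
      ; ∣K∣ = sym (+-identityʳ _)
      ; segment = λ { {zero} _ → H , (λ x∈ → x∈) , sym (+-identityʳ _) ,
          ≤-trans (p⊆q⇒∣p∣≤∣q∣ (⊛-closed H≤ (λ x∈ → x∈) h)) (m≤m+n ∣ H ∣ _) ; {suc _} (s≤s ()) }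
      }

    module _ {K m g} (K≤ : IsSubgroup K) (ord : Order K g m) where

      open Extension K≤ ord
      private
        module K = IsSubgroup K≤

      cosets-∙ : ∀ {x y} q i j → i + j < q → x // i · g ∈ K → y // j · g ∈ K → x ∙ y ∈ cosets K g q
      cosets-∙ {x} {y} q i j i+j<q x∈ y∈ = ∈-cosets⁺ K g i+j<q (subst (_∈ K)
        (trans (solve 4 (λ x y a b → x ⊙ a ⁻ ⊙ (y ⊙ b ⁻) , x ⊙ y ⊙ (a ⊙ b) ⁻) refl x y (i · g) (j · g))
          (cong (x ∙ y //_) (sym (·-homo-+ g i j))))
        (K.∙∈ x∈ y∈))

      -- Each summand has a coset number at most q. If all numbers are q, the sum lies in coset j *
      -- q with K-part in j ⊛ I; if some number is smaller, the total stays below j * q.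
      ⊛-segment : ∀ {I} q → I ⊆ K → ∀ j →
                  j ⊛ (cosets K g q ∪ shift (q · g) I) ⊆ cosets K g (j * q) ∪ shift ((j * q) · g) (j ⊛ I)
      ⊛-segment q I⊆K zero z∈ = x∈p∪q⁺ (inj₂ (subst (_∈ shift ε ⁅ ε ⁆) (identityˡ _) (∙∈shift z∈)))
      ⊛-segment {I} q I⊆K (suc j) z∈ with ∈-⊕⁻ (cosets K g q ∪ shift (q · g) I) _ z∈
      ... | x , y , x∈ , y∈ , refl with x∈p∪q⁻ (cosets K g q) _ x∈ | x∈p∪q⁻ (cosets K g (j * q)) _ (⊛-segment q I⊆K j y∈)
      ... | inj₂ x∈I | inj₂ y∈I = x∈p∪q⁺ (inj₂ (∈-shift⁺ (subst (_∈ I ⊕ j ⊛ I)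
            (trans (solve 4 (λ x y a b → x ⊙ a ⁻ ⊙ (y ⊙ b ⁻) , x ⊙ y ⊙ (a ⊙ b) ⁻) refl x y (q · g) ((j * q) · g))
              (cong (x ∙ y //_) (sym (·-homo-+ g q (j * q)))))
            (∈-⊕⁺ (∈-shift⁻ x∈I) (∈-shift⁻ y∈I)))))
      ... | inj₁ x∈T | inj₁ y∈T with i , i<q , x∈i ← ∈-cosets⁻ K g q x∈T with i′ , i′<jq , y∈i ← ∈-cosets⁻ K g (j * q) y∈T =
        x∈p∪q⁺ (inj₁ (cosets-∙ (q + j * q) i i′ (+-mono-< i<q i′<jq) x∈i y∈i))
      ... | inj₁ x∈T | inj₂ y∈I with i , i<q , x∈i ← ∈-cosets⁻ K g q x∈T =
        x∈p∪q⁺ (inj₁ (cosets-∙ (q + j * q) i (j * q) (+-mono-<-≤ i<q ≤-refl) x∈i (⊛-closed K≤ I⊆K j (∈-shift⁻ y∈I))))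
      ... | inj₂ x∈I | inj₁ y∈T with i′ , i′<jq , y∈i ← ∈-cosets⁻ K g (j * q) y∈T =
        x∈p∪q⁺ (inj₁ (cosets-∙ (q + j * q) q i′ (+-mono-≤-< ≤-refl i′<jq) (I⊆K (∈-shift⁻ x∈I)) y∈i))

      -- q full cosets of K followed by a segment of the next one.
      segments-step : Segments K → Segments extension
      segments-step S = record
        { index = m * S.index
        ; ∣K∣ = trans ∣extension∣ (trans (cong (m *_) S.∣K∣) (sym (*-assoc m S.index ∣ H ∣)))
        ; segment = λ {r} r< → segment r r<
        }
        where
        module S = Segments S
        instance
          index≢0 : NonZero S.index
          index≢0 = ≢-nonZero λ eq → <⇒≢ (0<∣subgroup∣ K≤) (sym (trans S.∣K∣ (cong (_* ∣ H ∣) eq)))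
        segment : ∀ r → r < m * S.index → ∃ λ I → I ⊆ extension × ∣ I ∣ ≡ suc r * ∣ H ∣ × ∣ h ⊛ I ∣ ≤ suc (h * r) * ∣ H ∣
        segment r r<
          with I , I⊆K , ∣I∣ , ∣hI∣ ← S.segment {r % S.index} (m%n<n r S.index) =
          cosets K g q ∪ shift (q · g) I , J⊆ , ∣J∣ , ∣hJ∣
          where
          open ≤-Reasoning
          -- Division by the index of H in K: the q full cosets of K and a segment of r % index + 1
          -- cosets of H make up r + 1 cosets of H.
          q = r / S.index
          q<m : q < m
          q<m = m<n*o⇒m/o<n r<
          J⊆ : cosets K g q ∪ shift (q · g) I ⊆ extension
          J⊆ z∈ with x∈p∪q⁻ (cosets K g q) _ z∈
          ... | inj₁ z∈T with i , _ , z∈i ← ∈-cosets⁻ K g q z∈T = ∈-extension⁺ i z∈i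
          ... | inj₂ z∈I = ∈-extension⁺ q (I⊆K (∈-shift⁻ z∈I))
          disjoint : Disjoint (cosets K g q) (shift (q · g) I)
          disjoint z∈T z∈I = cosets-disjoint q<m z∈T (∈-shift⁺ (I⊆K (∈-shift⁻ z∈I)))
          ∣J∣ : ∣ cosets K g q ∪ shift (q · g) I ∣ ≡ suc r * ∣ H ∣
          ∣J∣ = begin-equality
            ∣ cosets K g q ∪ shift (q · g) I ∣                 ≡⟨ ≤-antisym (∣∪∣≤ (cosets K g q) _) (∣⊎∣≤ disjoint (p⊆p∪q _) (q⊆p∪q (cosets K g q) _)) ⟩
            ∣ cosets K g q ∣ + ∣ shift (q · g) I ∣             ≡⟨ cong₂ _+_ (trans (∣cosets∣ (<⇒≤ q<m)) (cong (q *_) S.∣K∣)) (trans (∣shift∣ (q · g) I) ∣I∣) ⟩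
            q * (S.index * ∣ H ∣) + suc (r % S.index) * ∣ H ∣  ≡⟨ solveℕ 4 (λ q e r x → q :* (e :* x) :+ (con 1 :+ r) :* x := (con 1 :+ (r :+ q :* e)) :* x) refl q S.index (r % S.index) (∣ H ∣) ⟩
            suc (r % S.index + q * S.index) * ∣ H ∣            ≡⟨ cong (λ s → suc s * ∣ H ∣) (m≡m%n+[m/n]*n r S.index) ⟨
            suc r * ∣ H ∣                                      ∎
          ∣hJ∣ : ∣ h ⊛ (cosets K g q ∪ shift (q · g) I) ∣ ≤ suc (h * r) * ∣ H ∣
          ∣hJ∣ = begin
            ∣ h ⊛ (cosets K g q ∪ shift (q · g) I) ∣
              ≤⟨ ∣cover∣≤ (x∈p∪q⁻ _ _ ∘ ⊛-segment q I⊆K h) ⟩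
            ∣ cosets K g (h * q) ∣ + ∣ shift ((h * q) · g) (h ⊛ I) ∣
              -- The number h * q may exceed m, where cosets repeat; the upper bound on their union
              -- holds regardless.
              ≤⟨ +-mono-≤ (≤-trans (∣cosets∣≤ K g (h * q)) (≤-reflexive (cong (h * q *_) S.∣K∣)))
                   (≤-trans (≤-reflexive (∣shift∣ ((h * q) · g) (h ⊛ I))) ∣hI∣) ⟩
            h * q * (S.index * ∣ H ∣) + suc (h * (r % S.index)) * ∣ H ∣
              ≡⟨ solveℕ 5 (λ h q e r x → h :* q :* (e :* x) :+ (con 1 :+ h :* r) :* x := (con 1 :+ h :* (r :+ q :* e)) :* x) refl h q S.index (r % S.index) (∣ H ∣) ⟩
            suc (h * (r % S.index + q * S.index)) * ∣ H ∣
              ≡⟨ cong (λ s → suc (h * s) * ∣ H ∣) (m≡m%n+[m/n]*n r S.index) ⟨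
            suc (h * r) * ∣ H ∣ ∎

    full-segments : IsSubgroup H → ∀ {r} → suc r * ∣ H ∣ ≤ n →
                    ∃ λ I → ∣ I ∣ ≡ suc r * ∣ H ∣ × ∣ h ⊛ I ∣ ≤ suc (h * r) * ∣ H ∣
    full-segments H≤ {r} le
      with M , _ , ⊤⊆M , S ← subgroup-induction ⊤ Segments (λ K≤ ord _ → segments-step K≤ ord) H≤ (segments-base H≤)
      with I , _ , ∣I∣ , ∣hI∣ ← Segments.segment S {r} (*-cancelʳ-≤ (suc r) (Segments.index S) ∣ H ∣
             {{>-nonZero (0<∣subgroup∣ H≤)}}
             (≤-trans le (≤-trans (≤-reflexive (sym (∣⊤∣≡n n))) (≤-trans (p⊆q⇒∣p∣≤∣q∣ ⊤⊆M) (≤-reflexive (Segments.∣K∣ S))))))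
      = I , ∣I∣ , ∣hI∣

  -- Places a subgroup given as a `Subset` between A and the inductively defined span, so that
  -- cardinalities can be compared.
  generated : ∀ A → ∃ λ S → IsSubgroup S × A ⊆ S × (∀ {x} → x ∈ S → InGen G A x)
  generated A = subgroup-induction A (λ K → ∀ {x} → x ∈ K → InGen G A x)
    (λ {K} {m} {g} _ _ g∈A K-gen {x} x∈ → let i , _ , x∈i = ∈-cosets⁻ K g m x∈ in
      subst (InGen G A) (x//y∙y x (i · g)) (op (K-gen x∈i) (InGen-· i (gen g∈A))))
    ⁅ε⁆-subgroup (λ x∈ → subst (InGen G A) (sym (x∈⁅y⁆⇒x≡y ε x∈)) unit)
    where
    InGen-· : ∀ k {x} → InGen G A x → InGen G A (k · x)
    InGen-· zero x∈ = unit
    InGen-· (suc k) x∈ = op x∈ (InGen-· k x∈)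

-- Maxima over the divisors.

module _ {X : Set} (φ : X → ℕ) where

  maximum : List X → ℕ
  maximum = foldr (λ x m → φ x ⊔ m) 0

  ≤-maximum : ∀ {x xs} → x ∈ˡ xs → φ x ≤ maximum xs
  ≤-maximum (here refl) = m≤m⊔n _ _
  ≤-maximum (there x∈) = ≤-trans (≤-maximum x∈) (m≤n⊔m _ _)

  maximum-attained : ∀ xs → 0 < maximum xs → ∃ λ x → x ∈ˡ xs × φ x ≡ maximum xs
  maximum-attained (x ∷ xs) pos with ≤-total (maximum xs) (φ x)
  ... | inj₁ le = x , here refl , sym (m≥n⇒m⊔n≡m le)
  ... | inj₂ le with y , y∈ , eq ← maximum-attained xs (subst (0 <_) (m≤n⇒m⊔n≡n le) pos) =
    y , there y∈ , trans eq (sym (m≤n⇒m⊔n≡n le))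

∣⇒∈divisors : ∀ {d n} .{{_ : NonZero n}} → suc d ∣ n → suc d ∈ˡ divisors n
∣⇒∈divisors {n = n} d∣n = ∈-filter⁺ (_∣? n) (∈-map⁺ suc (∈-upTo⁺ (∣⇒≤ d∣n))) d∣n

∈divisors⇒∣ : ∀ {d n} → d ∈ˡ divisors n → d ∣ n
∈divisors⇒∣ {n = n} d∈ = proj₂ (∈-filter⁻ (_∣? n) {xs = map suc (upTo n)} d∈)

module _ {n h : ℕ} .{{_ : NonZero n}} .{{_ : NonZero h}} where

  f≤v : ∀ {d} → suc d ∣ n → f (suc d) n h ≤ v n h
  f≤v = ≤-maximum (λ d → f d n h) ∘ ∣⇒∈divisors

  -- The hypothesis on j says that j ≤ ⌊(d − 2) / h⌋.
  ≤v : ∀ {d l j} → n ≡ d * l → h * j + 2 ≤ d → suc j * l ≤ v n h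
  ≤v {suc zero} {j = j} _ hj+2≤d = contradiction (≤-trans (m≤n+m 2 (h * j)) hj+2≤d) λ { (s≤s ()) }
  ≤v {zero} {j = j} _ hj+2≤d = contradiction (≤-trans (m≤n+m 2 (h * j)) hj+2≤d) λ ()
  ≤v {suc (suc k)} {l} {j} n≡ hj+2≤d = begin
    suc j * l                          ≤⟨ *-monoˡ-≤ l (≤-trans (s≤s j≤k/h) (≤-reflexive (+-comm 1 (k / h)))) ⟩
    (k / h + 1) * l                    ≡⟨ cong ((k / h + 1) *_) l≡ ⟩
    f (suc (suc k)) n h                ≤⟨ f≤v (divides l (trans n≡ (*-comm (suc (suc k)) l))) ⟩
    v n h                              ∎
    where
    open ≤-Reasoning
    l≡ : l ≡ n / suc (suc k)
    l≡ = sym (trans (/-congˡ {o = suc (suc k)} (trans n≡ (*-comm (suc (suc k)) l))) (m*n/n≡m l (suc (suc k))))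
    j≤k/h : j ≤ k / h
    j≤k/h = ≤-trans (≤-reflexive (sym (m*n/n≡m j h)))
      (/-monoˡ-≤ h (≤-trans (≤-reflexive (*-comm j h)) (+-cancelʳ-≤ 2 (h * j) k (≤-trans hj+2≤d (≤-reflexive (+-comm 2 k))))))

-- Both bounds combined, with suc h as the number of summands.

module Critical {n : ℕ} (2≤n : 2 ≤ n) (G : FinAbGroup n) (h : ℕ) where

  open Sumsets G
  open Isoperimetry G
  open UpperBound G
  open Extensions G
  open LowerBound G

  private instance
    n≢0 : NonZero n
    n≢0 = >-nonZero (<⇒≤ 2≤n)

  private
    v′ : ℕ
    v′ = v n (suc h)

  -- A missed x would give a `Bound` with M the whole group, whence ∣ A ∣ ≤ v.
  chiProp : ChiProp G (suc h) (v′ + 1)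
  chiProp A v<∣A∣ x = ∈-⊛⇒InSumset (suc h) (decidable-stable (x ∈? (suc h ⊛ A)) λ x∉ →
    let _ , a∈A = 0<∣∣⇒nonempty {p = A} (≤-trans (m≤n+m 1 v′) v<∣A∣)
        open Bound (upperBound h ⊤-subgroup (<-wellFounded _) ⊆⊤ a∈A ∈⊤ x∉)
    in <⇒≱ (≤-trans (≤-reflexive (+-comm 1 v′)) v<∣A∣)
         (≤-trans ∣A∣ (≤v {h = suc h} {d = d} {j = k} (trans (sym (∣⊤∣≡n n)) ∣M∣) hk+2≤d)))

  -- The divisor d = n contributes at least 1, because n ≥ 2.
  0<v : 0 < v′
  0<v = ≤v {h = suc h} {l = 1} {j = 0} (sym (*-identityʳ n)) (≤-trans (≤-reflexive (cong (_+ 2) (*-zeroʳ (suc h)))) 2≤n)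

  abstract
    -- For a divisor d attaining v take a subgroup of order n / d and a segment of r + 1 cosets, r =
    -- ⌊(d - 2) / suc h⌋. Its sumset has at most (suc h * r + 1) * (n / d) ≤ (d - 1) * (n / d) < n
    -- elements.
    extremal : ∃ λ I → ∣ I ∣ ≡ v′ × ∣ suc h ⊛ I ∣ < n
    extremal with maximum-attained (λ d → f d n (suc h)) (divisors n) 0<v
    -- As f vanishes at 0 and 1 while v is positive, the maximum is attained at some d ≥ 2.
    ... | zero , _ , eq = contradiction 0<v (≤⇒≯ (≤-reflexive (sym eq)))
    ... | suc zero , _ , eq = contradiction 0<v (≤⇒≯ (≤-reflexive (sym eq)))
    ... | d@(suc (suc k)) , d∈ , eq = conclude
      where
      open ≤-Reasoning
      d∣n : d ∣ n
      d∣n = ∈divisors⇒∣ d∈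
      l : ℕ
      l = n / d
      n≡ : d * l ≡ n
      n≡ = trans (*-comm d l) (m/n*n≡m d∣n)
      l∣n : l ∣ n
      l∣n = divides d (sym n≡)
      instance
        l≢0 : NonZero l
        l≢0 = ≢-nonZero λ l≡0 → <⇒≢ (<⇒≤ 2≤n) (trans (sym (*-zeroʳ d)) (trans (cong (d *_) (sym l≡0)) n≡))
      r : ℕ
      r = k / suc h
      hr≤k : suc h * r ≤ k
      hr≤k = ≤-trans (≤-reflexive (*-comm (suc h) r)) (m/n*n≤m k (suc h))
      conclude : ∃ λ I → ∣ I ∣ ≡ v′ × ∣ suc h ⊛ I ∣ < n
      conclude
        with H , H≤ , ∣H∣ ← subgroup-of-order l l∣n
        with I , ∣I∣ , ∣hI∣ ← full-segments (suc h) H H≤ {r} (begin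
          suc r * ∣ H ∣     ≡⟨ cong (suc r *_) ∣H∣ ⟩
          suc r * l         ≤⟨ *-monoˡ-≤ l (s≤s (≤-trans (m/n≤m k (suc h)) (n≤1+n k))) ⟩
          d * l             ≡⟨ n≡ ⟩
          n                 ∎)
        = I , trans ∣I∣ (trans (cong₂ _*_ (+-comm 1 r) ∣H∣) eq) , (begin-strict
          ∣ suc h ⊛ I ∣              ≤⟨ ∣hI∣ ⟩
          suc (suc h * r) * ∣ H ∣    ≡⟨ cong (suc (suc h * r) *_) ∣H∣ ⟩
          suc (suc h * r) * l        <⟨ *-monoˡ-< l (s≤s (s≤s hr≤k)) ⟩
          d * l                      ≡⟨ n≡ ⟩
          n                          ∎)

    ∣∣<n⇒misses : ∀ X → ∣ X ∣ < n → Misses ⊤ X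
    ∣∣<n⇒misses X X<n = decidable-stable (misses? ⊤ X) λ ¬miss →
      <⇒≱ X<n (≤-trans (≤-reflexive (sym (∣⊤∣≡n n))) (p⊆q⇒∣p∣≤∣q∣ (¬misses⇒⊇ ¬miss)))

  -- A set of cardinality v that avoids ε generates G: it is strictly smaller than the
  -- subgroup it generates, whereas a proper subgroup of index d has at most f_d ≤ v elements.
  ε∉⇒generates : ∀ {A} → ε ∉ A → ∣ A ∣ ≡ v′ → Generates G A
  ε∉⇒generates {A} ε∉A ∣A∣ with generated A
  ... | S , S≤ , A⊆S , S-gen with lagrange S≤
  ...   | zero , n≡ = contradiction n≡ λ { refl → contradiction 2≤n λ () }
  ...   | suc zero , n≡ = λ x → S-gen (subst (x ∈_) (sym (∣p∣≡n⇒p≡⊤ (trans (sym (+-identityʳ _)) (sym n≡)))) ∈⊤)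
  ...   | suc (suc e) , n≡ = contradiction (≤v {h = suc h} {d = suc (suc e)} {j = 0} n≡
            (≤-trans (≤-reflexive (cong (_+ 2) (*-zeroʳ (suc h)))) (s≤s (s≤s z≤n))))
            (<⇒≱ (≤-trans (≤-reflexive (cong suc (sym ∣A∣))) (≤-trans
              (p⊂q⇒∣p∣<∣q∣ (A⊆S , ε , IsSubgroup.ε∈ S≤ , ε∉A)) (≤-reflexive (sym (+-identityʳ _))))))

  generating-extremal : ∃ λ A → Generates G A × ∣ A ∣ ≡ v′ × ¬ SumsetFull G (suc h) A
  generating-extremal
    with I , ∣I∣ , hI<n ← extremal
    with x , _ , x∉ ← ∣∣<n⇒misses (suc h ⊛ I) hI<n
    with s , s∈ ← ⊛-nonempty (0<∣∣⇒nonempty {p = I} (subst (0 <_) (sym ∣I∣) 0<v)) h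
    = A , ε∉⇒generates ε∉A (trans (∣shift∣ (w ⁻¹) I) ∣I∣) , trans (∣shift∣ (w ⁻¹) I) ∣I∣ ,
      -- A full sumset of A = I - w would contain x - suc h · w; adding w back to every summand
      -- would give x ∈ suc h ⊛ I.
      λ full → x∉ (subst (_∈ suc h ⊛ I) (x//y∙y x (suc h · w))
        (⊛-untranslate I w A∙w⊆I (suc h) (InSumset⇒∈-⊛ (suc h) (full (x // suc h · w)))))
    where
    -- Here x is missed by suc h ⊛ I and s ∈ h ⊛ I, so w ∉ I: otherwise x = w + s would be in the
    -- sumset. Hence I - w avoids ε.
    w = x // s
    A = shift (w ⁻¹) I
    A∙w⊆I : ∀ {z} → z ∈ A → z ∙ w ∈ I
    A∙w⊆I z∈ = subst (_∈ I) (solve 2 (λ z w → z ⊙ w ⁻ ⁻ , z ⊙ w) refl _ w) (∈-shift⁻ z∈)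
    ε∉A : ε ∉ A
    ε∉A ε∈ = x∉ (subst (_∈ suc h ⊛ I) (solve 2 (λ x s → 𝟙 ⊙ (x ⊙ s ⁻) ⊙ s , x) refl x s)
      (∈-⊕⁺ (A∙w⊆I ε∈) s∈))

  chiHat-lower : ∀ k → ChiHatProp G (suc h) k → v′ + 1 ≤ k
  chiHat-lower k hat with A , A-gen , ∣A∣ , ¬full ← generating-extremal =
    ≤-trans (≤-reflexive (+-comm v′ 1)) (≰⇒> λ k≤v → ¬full (hat A A-gen (≤-trans k≤v (≤-reflexive (sym ∣A∣)))))

  -- The property for all sets implies the one for generating sets, so the upper bound for χ and the
  -- lower bound for the generating version settle both minima.
  minima : IsMinimum (ChiHatProp G (suc h)) (v′ + 1) × IsMinimum (ChiProp G (suc h)) (v′ + 1)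
  minima = ((λ A _ → chiProp A) , chiHat-lower) ,
           (chiProp , λ k chi → chiHat-lower k λ A _ → chi A)

theorem4 : (n : ℕ) → 2 ≤ n → (G : FinAbGroup n) → (h : ℕ) → .{{_ : NonZero h}} →
    IsMinimum (ChiHatProp G h) (v n h + 1) × IsMinimum (ChiProp G h) (v n h + 1)
theorem4 n 2≤n G (suc h) = Critical.minima 2≤n G h
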